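{- Let $T$ be a forest that is not a subgraph of a $1$-subdivided tree, and let $k$ be a positive integer. Then the class of all $(T,C_4,\dots,C_{2k},\text{odd hole})$-free graphs is not $\chi_s$-bounded.
   Context: All graphs are finite, simple and undirected. A $1$-subdivided tree is a graph obtained from a tree by subdividing each edge by exactly one vertex. $C_n$ is the cycle of length $n$. An odd hole is an induced cycle of odd length at least $5$. A graph is $(T,C_4,\dots,C_{2k},\text{odd hole})$-free if it contains none of $T$, $C_4,\dots,C_{2k}$ as an induced subgraph and contains no odd hole (for $k=1$ the list $C_4,\dots,C_{2k}$ is empty). The star chromatic number $\chi_s(G)$ is the minimum number of colors in a proper coloring of $G$ such that the union of any two color classes induces a star forest. A hereditary class $\mathscr C$ is $\chi_s$-bounded if there is a function $f$ such that $\chi_s(G)\leq f(\omega(G))$ for every $G\in\mathscr C$, where $\omega$ is the clique number. -}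

module Defs where

open import Data.Nat.Base using (ℕ; suc; _+_; _*_; _≤_; _<_)
import Data.Nat.Properties as ℕ
open import Data.Nat.Divisibility using (_∣_)
open import Data.Fin.Base using (Fin; toℕ; splitAt)
import Data.Fin.Properties as Fin
open import Data.List.Base using (List; length; lookup; filter; allFin; cartesianProduct)
open import Data.Product using (Σ; ∃; _×_; _,_; proj₁; proj₂)
open import Data.Sum using (_⊎_; inj₁; inj₂; swap)
open import Data.Empty using (⊥)
open import Function.Base using (_on_)
open import Function.Bundles using (_⇔_)
open import Function.Definitions using (Injective)
open import Level using (Level; 0ℓ; _⊔_)
open import Relation.Binary using (Rel; Symmetric; Irreflexive; Decidable)
open import Relation.Binary.Construct.Closure.ReflexiveTransitive using (Star)
open import Relation.Binary.PropositionalEquality using (_≡_; _≢_; refl; ≢-sym)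
open import Relation.Nullary using (¬_; no)
open import Relation.Nullary.Decidable using (¬?; _×-dec_; _⊎-dec_)
open import Relation.Unary using (Pred)

record Graph : Set₁ where
  field
    order : ℕ

  V : Set
  V = Fin order

  field
    Adj        : Rel V 0ℓ
    adj?       : Decidable Adj
    adj-sym    : Symmetric Adj
    adj-irrefl : Irreflexive _≡_ Adj

open Graph

_IsSubgraphOf_ : Rel Graph 0ℓ
H IsSubgraphOf G = Σ (V H → V G) λ f →
  Injective _≡_ _≡_ f × (∀ u v → Adj H u v → Adj G (f u) (f v))

_IsInducedSubgraphOf_ : Rel Graph 0ℓ
H IsInducedSubgraphOf G = Σ (V H → V G) λ f →
  Injective _≡_ _≡_ f × (∀ u v → Adj H u v ⇔ Adj G (f u) (f v))

K : ℕ → Graph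
K n = record
  { order      = n
  ; Adj        = _≢_
  ; adj?       = λ u v → ¬? (u Fin.≟ v)
  ; adj-sym    = ≢-sym
  ; adj-irrefl = λ u≡v u≢v → u≢v u≡v
  }

-- Cyclic successor on Fin n.
Next : ∀ n → Rel (Fin n) 0ℓ
Next n i j = (suc (toℕ i) ≡ toℕ j) ⊎ (suc (toℕ i) ≡ n × toℕ j ≡ 0)

next? : ∀ n → Decidable (Next n)
next? n i j = (suc (toℕ i) ℕ.≟ toℕ j) ⊎-dec ((suc (toℕ i) ℕ.≟ n) ×-dec (toℕ j ℕ.≟ 0))

-- The cycle of length n when 3 ≤ n; for smaller n this is only a junk value
-- (the complete graph on n vertices), so every use below bounds n from below.
C : ℕ → Graph
C n = record
  { order      = n
  ; Adj        = λ i j → i ≢ j × (Next n i j ⊎ Next n j i)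
  ; adj?       = λ i j → ¬? (i Fin.≟ j) ×-dec (next? n i j ⊎-dec next? n j i)
  ; adj-sym    = λ (i≢j , p) → ≢-sym i≢j , swap p
  ; adj-irrefl = λ i≡j (i≢j , _) → i≢j i≡j
  }

IsForest : Pred Graph 0ℓ
IsForest G = ∀ n → 3 ≤ n → ¬ (C n IsSubgraphOf G)

IsConnected : Pred Graph 0ℓ
IsConnected G = ∀ u v → Star (Adj G) u v

IsTree : Pred Graph 0ℓ
IsTree G = 0 < order G × IsConnected G × IsForest G

-- Each edge is listed exactly once, with its smaller endpoint first.
edges : (G : Graph) → List (V G × V G)
edges G = filter (λ (u , v) → (u Fin.<? v) ×-dec adj? G u v)
                 (cartesianProduct (allFin (order G)) (allFin (order G)))

module _ (G : Graph) where

  Incident : V G → Fin (length (edges G)) → Set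
  Incident v e = v ≡ proj₁ (lookup (edges G) e) ⊎ v ≡ proj₂ (lookup (edges G) e)

  SubdivAdj : Rel (V G ⊎ Fin (length (edges G))) 0ℓ
  SubdivAdj (inj₁ v) (inj₂ e) = Incident v e
  SubdivAdj (inj₂ e) (inj₁ v) = Incident v e
  SubdivAdj (inj₁ _) (inj₁ _) = ⊥
  SubdivAdj (inj₂ _) (inj₂ _) = ⊥

  subdivAdj? : Decidable SubdivAdj
  subdivAdj? (inj₁ v) (inj₂ e) = (v Fin.≟ _) ⊎-dec (v Fin.≟ _)
  subdivAdj? (inj₂ e) (inj₁ v) = (v Fin.≟ _) ⊎-dec (v Fin.≟ _)
  subdivAdj? (inj₁ _) (inj₁ _) = no λ ()
  subdivAdj? (inj₂ _) (inj₂ _) = no λ ()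

  subdivAdj-sym : Symmetric SubdivAdj
  subdivAdj-sym {inj₁ _} {inj₂ _} p = p
  subdivAdj-sym {inj₂ _} {inj₁ _} p = p

  subdivAdj-irrefl : ∀ x → ¬ SubdivAdj x x
  subdivAdj-irrefl (inj₁ _) ()
  subdivAdj-irrefl (inj₂ _) ()

  subdivide : Graph
  subdivide = record
    { order      = order G + length (edges G)
    ; Adj        = SubdivAdj on splitAt (order G)
    ; adj?       = λ x y → subdivAdj? (splitAt (order G) x) (splitAt (order G) y)
    ; adj-sym    = λ {x} {y} → subdivAdj-sym {splitAt (order G) x} {splitAt (order G) y}
    ; adj-irrefl = λ { {x} refl → subdivAdj-irrefl (splitAt (order G) x) }
    }

-- Adjacency in the subgraph of G induced by the vertices satisfying P.
_[_] : (G : Graph) → Pred (V G) 0ℓ → Rel (V G) 0ℓ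
(G [ P ]) u v = P u × P v × Adj G u v

-- Every component of the induced subgraph is a star K₁,ₜ with t ≥ 0: the
-- component of v has a centre c, and two distinct vertices of the component
-- are adjacent exactly when one of them is c.
InducesStarForest : (G : Graph) → Pred (V G) 0ℓ → Set
InducesStarForest G P = ∀ v → P v → ∃ λ c → Star (G [ P ]) v c ×
  (∀ u w → Star (G [ P ]) v u → Star (G [ P ]) v w →
    (G [ P ]) u w ⇔ (u ≢ w × (u ≡ c ⊎ w ≡ c)))

IsStarColoring : (G : Graph) {m : ℕ} → (V G → Fin m) → Set
IsStarColoring G col =
  (∀ u v → Adj G u v → col u ≢ col v) ×
  (∀ a b → a ≢ b → InducesStarForest G (λ v → col v ≡ a ⊎ col v ≡ b))

StarColorable : Graph → ℕ → Set
StarColorable G m = Σ (V G → Fin m) (IsStarColoring G)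

-- χₛ and ω as functional relations: the least m admitting a star coloring with
-- m colors, and the greatest w such that G contains a clique on w vertices.
IsStarChromaticNumber : Graph → ℕ → Set
IsStarChromaticNumber G m = StarColorable G m × (∀ j → StarColorable G j → m ≤ j)

IsCliqueNumber : Graph → ℕ → Set
IsCliqueNumber G w = (K w IsSubgraphOf G) × (∀ j → K j IsSubgraphOf G → j ≤ w)

χₛ-Bounded : {ℓ : Level} → Pred Graph ℓ → Set (Level.suc 0ℓ ⊔ ℓ)
χₛ-Bounded 𝒞 = Σ (ℕ → ℕ) λ f → ∀ G → 𝒞 G →
  ∀ m w → IsStarChromaticNumber G m → IsCliqueNumber G w → m ≤ f w

HasOddHole : Pred Graph 0ℓ
HasOddHole G = ∃ λ n → 5 ≤ n × ¬ (2 ∣ n) × C n IsInducedSubgraphOf G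

-- The (T, C₄, …, C₂ₖ, odd hole)-free graphs. Once odd holes are excluded, it
-- makes no difference whether C₄, …, C₂ₖ lists all lengths or only even ones.
Free : Graph → ℕ → Pred Graph 0ℓ
Free T k G =
  ¬ (T IsInducedSubgraphOf G) ×
  (∀ n → 4 ≤ n → n ≤ 2 * k → ¬ (C n IsInducedSubgraphOf G)) ×
  ¬ HasOddHole G

{-# OPTIONS --safe #-}
module Submission where

-- The counterexamples are the 1-subdivisions of graphs H of girth above k and large
-- chromatic number. Such a subdivision is bipartite, has twice the girth of H, and clique
-- number 2. If it contained the forest T, every vertex of T on a subdivision vertex would
-- have degree at most 2; contracting these vertices gives a forest F, and T embeds in the
-- 1-subdivision of any tree containing F. Finally, given a star colouring with m colours,
-- fix a vertex colour class of H: edges inside it whose subdivision vertices share a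
-- colour form a matching, so the class can be coloured greedily with m + 1 colours, and H
-- has a proper colouring with m (m + 1) colours.
--
-- H is built greedily on n vertices, n being large compared to the number q of colours and
-- the girth. As long as few edges are present, at least half of the vertices have degree
-- below a fixed bound Δ. Excluding the pairs with a vertex of degree Δ or at distance at
-- most g, every q-colouring is still monochromatic on n² / D of the n² pairs, D = 8 q².
-- Hence some admissible pair is monochromatic in a fraction 1 / D of the colourings that
-- are still proper, and adding it as an edge removes those. After q (D - 1) n steps fewer
-- than one of the qⁿ colourings is left.

open import Defs
open import Data.Empty using (⊥; ⊥-elim)
open import Data.Fin.Base
  using (Fin; zero; suc; toℕ; fromℕ; fromℕ<; inject₁; inject≤; splitAt; join; combine; finToFun; funToFin)
open import Data.Fin.Induction using (<-weakInduction)
import Data.Fin.Properties as Fin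
open import Data.List.Base using (List; length; lookup; allFin; cartesianProduct)
open import Data.List.Membership.Propositional using (_∈_)
open import Data.List.Membership.Propositional.Properties
  using (∈-filter⁺; ∈-filter⁻; ∈-cartesianProduct⁺; ∈-allFin; ∈-lookup)
import Data.List.Relation.Unary.All as All
open import Data.List.Relation.Unary.AllPairs using (_∷_)
import Data.List.Relation.Unary.Any as Any
open import Data.List.Relation.Unary.Any.Properties using (lookup-index)
open import Data.List.Relation.Unary.Unique.Propositional using (Unique)
import Data.List.Relation.Unary.Unique.Propositional.Properties as Unique
open import Data.Nat.Base
open import Data.Nat.Divisibility using (_∣_; divides; ∣m∣n⇒∣m+n; ∣-refl)
open import Data.Nat.Induction using (<-rec)
import Data.Nat.Properties as ℕ
open import Data.Nat.Tactic.RingSolver using (solve-∀)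
open import Data.Product using (∃; ∃₂; _×_; _,_; proj₁; proj₂)
open import Data.Sum using (_⊎_; inj₁; inj₂; swap)
open import Function.Base using (_∘_; id; case_of_)
open import Function.Bundles using (Equivalence; mk⇔)
open import Function.Definitions using (Injective)
open import Level using (0ℓ)
open import Relation.Binary using (Rel; Symmetric; Irreflexive; Decidable; tri<; tri≈; tri>)
open import Relation.Binary.Construct.Closure.ReflexiveTransitive as Star using (Star; ε; _◅_; _◅◅_)
open import Relation.Binary.PropositionalEquality hiding ([_])
open import Relation.Nullary using (¬_; Dec; yes; no)
open import Relation.Nullary.Decidable
  using (¬?; _×-dec_; _⊎-dec_; _→-dec_; ¬¬-excluded-middle; decidable-stable)
open import Relation.Unary using (Pred)
import Relation.Unary as U
open import Algebra.Properties.Semiring.Sum ℕ.+-*-semiring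
  using (sum; sum-cong-≗; ∑-distrib-+; ∑-comm; *-distribˡ-sum; *-distribʳ-sum)

private variable
  X Y : Set
  R : Rel X 0ℓ
  g ℓ ℓ′ m n : ℕ
  u v w x y : X
  P Q : Pred (Fin n) 0ℓ

-- Walks and their vertices

infixr 5 _∷_ _++_

data Walk {X : Set} (R : Rel X 0ℓ) : ℕ → Rel X 0ℓ where
  []  : Walk R 0 u u
  _∷_ : R u v → Walk R ℓ v w → Walk R (suc ℓ) u w

_++_ : Walk R ℓ u v → Walk R ℓ′ v w → Walk R (ℓ + ℓ′) u w
[]       ++ q = q
(r ∷ p) ++ q = r ∷ p ++ q

_∷ʳ_ : Walk R ℓ u v → R v w → Walk R (suc ℓ) u w
[]       ∷ʳ s = s ∷ []
(r ∷ p) ∷ʳ s = r ∷ (p ∷ʳ s)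

reverse : Symmetric R → Walk R ℓ u v → Walk R ℓ v u
reverse sy []       = []
reverse sy (r ∷ p) = reverse sy p ∷ʳ sy r

map : {S : Rel Y 0ℓ} (f : X → Y) → (∀ {a b} → R a b → S (f a) (f b)) →
      Walk R ℓ u v → Walk S ℓ (f u) (f v)
map f h []       = []
map f h (r ∷ p) = h r ∷ map f h p

-- Past its end the walk stays at its last vertex, so positions can be plain naturals.
at : {X : Set} {R : Rel X 0ℓ} {u v : X} → Walk R ℓ u v → ℕ → X
at {u = u} []       i       = u
at {u = u} (r ∷ p) zero    = u
at         (r ∷ p) (suc i) = at p i

at-last : (p : Walk R ℓ u v) → at p ℓ ≡ v
at-last []      = refl
at-last (r ∷ p) = at-last p

at-first : (p : Walk R ℓ u v) → at p 0 ≡ u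
at-first []      = refl
at-first (r ∷ p) = refl

at-step : (p : Walk R ℓ u v) → ∀ {i} → i < ℓ → R (at p i) (at p (suc i))
at-step {R = R} {u = u} (r ∷ p) {zero} _ = subst (R u) (sym (at-first p)) r
at-step (r ∷ p) {suc i} (s≤s i<ℓ) = at-step p i<ℓ

take : (p : Walk R ℓ u v) → ∀ {i} → i ≤ ℓ → Walk R i u (at p i)
take []      {zero}  _         = []
take (r ∷ p) {zero}  _         = []
take (r ∷ p) {suc i} (s≤s i≤ℓ) = r ∷ take p i≤ℓ

drop : (p : Walk R ℓ u v) → ∀ {i} → i ≤ ℓ → Walk R (ℓ ∸ i) (at p i) v
drop []      {zero}  _         = []
drop (r ∷ p) {zero}  _         = r ∷ p
drop (r ∷ p) {suc i} (s≤s i≤ℓ) = drop p i≤ℓ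

-- Girth and acyclicity in terms of walks

SamePair : X → X → X → X → Set
SamePair u v a b = (a ≡ u × b ≡ v) ⊎ (a ≡ v × b ≡ u)

_∖⟨_,_⟩ _∪⟨_,_⟩ : Rel X 0ℓ → X → X → Rel X 0ℓ
(R ∖⟨ u , v ⟩) a b = R a b × ¬ SamePair u v a b
(R ∪⟨ u , v ⟩) a b = R a b ⊎ SamePair u v a b

samePair-sym : SamePair u v x y → SamePair u v y x
samePair-sym (inj₁ (a , b)) = inj₂ (b , a)
samePair-sym (inj₂ (a , b)) = inj₁ (b , a)

∖-sym : Symmetric R → Symmetric (R ∖⟨ u , v ⟩)
∖-sym sy (r , ¬s) = sy r , ¬s ∘ samePair-sym

-- Every edge lies on no cycle of length at most g + 1.
GirthAbove : ℕ → Rel X 0ℓ → Set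
GirthAbove g R = ∀ {u v} → R u v → ∀ {ℓ} → ℓ ≤ g → ¬ Walk (R ∖⟨ u , v ⟩) ℓ u v

-- Every edge is a bridge. With walks in place of cycles of distinct vertices, adding or contracting
-- an edge is a matter of splicing.
Acyclic : Rel X 0ℓ → Set
Acyclic R = ∀ g → GirthAbove g R

-- Whatever lies between two uses of the new edge can be cut out: two uses in the same direction
-- merge into one, two in opposite directions cancel. Lengths only shrink, hence the inequalities.
split-∪ : Walk (R ∪⟨ x , y ⟩) ℓ u v →
  (∃ λ i → i ≤ ℓ × Walk R i u v) ⊎
  (∃₂ λ i j → i + suc j ≤ ℓ × Walk R i u x × Walk R j y v) ⊎
  (∃₂ λ i j → i + suc j ≤ ℓ × Walk R i u y × Walk R j x v)
split-∪ [] = inj₁ (0 , z≤n , [])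
split-∪ (inj₁ r ∷ p) with split-∪ p
... | inj₁ (i , i≤ℓ , q)                    = inj₁ (suc i , s≤s i≤ℓ , r ∷ q)
... | inj₂ (inj₁ (i , j , le , q₁ , q₂)) = inj₂ (inj₁ (suc i , j , s≤s le , r ∷ q₁ , q₂))
... | inj₂ (inj₂ (i , j , le , q₁ , q₂)) = inj₂ (inj₂ (suc i , j , s≤s le , r ∷ q₁ , q₂))
split-∪ (inj₂ (inj₁ (refl , refl)) ∷ p) with split-∪ p
... | inj₁ (i , i≤ℓ , q)                    = inj₂ (inj₁ (0 , i , s≤s i≤ℓ , [] , q))
... | inj₂ (inj₁ (i , j , le , q₁ , q₂)) =
  inj₂ (inj₁ (0 , j , s≤s (ℕ.≤-trans (ℕ.n≤1+n j) (ℕ.m+n≤o⇒n≤o i le)) , [] , q₂))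
... | inj₂ (inj₂ (i , j , le , q₁ , q₂)) =
  inj₁ (j , ℕ.m≤n⇒m≤1+n (ℕ.≤-trans (ℕ.n≤1+n j) (ℕ.m+n≤o⇒n≤o i le)) , q₂)
split-∪ (inj₂ (inj₂ (refl , refl)) ∷ p) with split-∪ p
... | inj₁ (i , i≤ℓ , q)                    = inj₂ (inj₂ (0 , i , s≤s i≤ℓ , [] , q))
... | inj₂ (inj₂ (i , j , le , q₁ , q₂)) =
  inj₂ (inj₂ (0 , j , s≤s (ℕ.≤-trans (ℕ.n≤1+n j) (ℕ.m+n≤o⇒n≤o i le)) , [] , q₂))
... | inj₂ (inj₁ (i , j , le , q₁ , q₂)) =
  inj₁ (j , ℕ.m≤n⇒m≤1+n (ℕ.≤-trans (ℕ.n≤1+n j) (ℕ.m+n≤o⇒n≤o i le)) , q₂)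

-- If a detour around an old edge `u v` uses the new edge `x y`, then exchanging the two edges turns
-- it into a walk from `x` to `y` through `u v` that is no longer than the detour. A detour around
-- the new edge is itself a walk from `x` to `y` in `R`.
∪-girth : Symmetric R → GirthAbove g R → (∀ {ℓ} → ℓ ≤ g → ¬ Walk R ℓ x y) →
          GirthAbove g (R ∪⟨ x , y ⟩)
∪-girth {R = R} {g} {x} {y} sy girth far {u} {v} (inj₁ r) ℓ≤g p
  with split-∪ {R = R ∖⟨ u , v ⟩}
         (map id (λ { (inj₁ r , ¬s) → inj₁ (r , ¬s) ; (inj₂ s , _) → inj₂ s }) p)
... | inj₁ (i , i≤ℓ , q) = girth r (ℕ.≤-trans i≤ℓ ℓ≤g) q
... | inj₂ (inj₁ (i , j , le , q₁ , q₂)) = far (ℕ.≤-trans le ℓ≤g)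
  (map id proj₁ (reverse (∖-sym sy) q₁) ++ r ∷ map id proj₁ (reverse (∖-sym sy) q₂))
... | inj₂ (inj₂ (i , j , le , q₁ , q₂)) = far (ℕ.≤-trans le ℓ≤g)
  (reverse sy (map id proj₁ (reverse (∖-sym sy) q₁) ++ r ∷ map id proj₁ (reverse (∖-sym sy) q₂)))
∪-girth sy girth far (inj₂ (inj₁ (refl , refl))) ℓ≤g p =
  far ℓ≤g (map id (λ { (inj₁ r , _) → r ; (inj₂ s , ¬s) → ⊥-elim (¬s s) }) p)
∪-girth sy girth far (inj₂ (inj₂ (refl , refl))) ℓ≤g p =
  far ℓ≤g (reverse sy (map id (λ { (inj₁ r , _) → r ; (inj₂ s , ¬s) → ⊥-elim (¬s (swap s)) }) p))

walk-along : (f : Fin (suc n) → X) → (∀ i → R (f (inject₁ i)) (f (suc i))) →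
             ∀ i → Walk R (toℕ i) (f zero) (f i)
walk-along {R = R} f step = <-weakInduction _ [] λ i p →
  subst (λ ℓ → Walk R ℓ (f zero) (f (suc i))) (cong suc (Fin.toℕ-inject₁ i)) (p ∷ʳ step i)

cycle-step : ∀ i → Graph.Adj (C (suc n)) (inject₁ i) (suc i)
cycle-step i = (λ eq → ℕ.1+n≢n (sym (trans (sym (Fin.toℕ-inject₁ i)) (cong toℕ eq))))
             , inj₁ (inj₁ (cong suc (Fin.toℕ-inject₁ i)))

cycle-close : ∀ n → Graph.Adj (C (2 + n)) zero (fromℕ (suc n))
cycle-close n = (λ ()) , inj₂ (inj₂ (cong suc (Fin.toℕ-fromℕ (suc n)) , refl))

-- The path `0, 1, …, n - 1` of length `n - 1 ≤ g` bypasses the closing edge of the cycle.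
-- Injectivity keeps it off that edge, and `3 ≤ n` ensures that its first step is not the closing
-- edge.
girth-noCycle : GirthAbove g R → 3 ≤ n → n ≤ suc g → (f : Fin n → X) → Injective _≡_ _≡_ f →
  (∀ i j → Graph.Adj (C n) i j → R (f i) (f j)) → ⊥
girth-noCycle {g = g} {R = R} {n = suc (suc (suc n))} girth (s≤s (s≤s (s≤s z≤n))) (s≤s n≤g) f inj hom =
  girth (hom zero last (cycle-close (suc n)))
        (ℕ.≤-trans (ℕ.≤-reflexive (Fin.toℕ-fromℕ (2 + n))) n≤g)
        (walk-along {R = R ∖⟨ f zero , f last ⟩} f step last)
  where
  last : Fin (3 + n)
  last = fromℕ (2 + n)

  step : ∀ i → (R ∖⟨ f zero , f last ⟩) (f (inject₁ i)) (f (suc i))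
  step i = hom _ _ (cycle-step i) , λ
    { (inj₁ (a , b)) → first-not-second i (inj a) (inj b)
    ; (inj₂ (_ , b)) → Fin.0≢1+n (sym (inj b)) }
    where
    first-not-second : ∀ i → inject₁ i ≡ zero → suc i ≡ last → ⊥
    first-not-second zero _ ()

-- A shortest walk bypassing an edge has no repeated vertex, since the part between two occurrences
-- could be cut out. It closes up with the edge to a cycle, of length at least 3 because neither a
-- loop nor the edge itself bypasses the edge.
forest-acyclic : (G : Graph) → IsForest G → Acyclic (Graph.Adj G)
forest-acyclic G forest _ {u} {v} r {ℓ} _ p = <-rec (λ ℓ → ¬ Walk R′ ℓ u v) step ℓ p
  where
  open Graph G
  R′ = Adj ∖⟨ u , v ⟩

  step : ∀ ℓ → (∀ {ℓ′} → ℓ′ < ℓ → ¬ Walk R′ ℓ′ u v) → ¬ Walk R′ ℓ u v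
  step 0 _ [] = adj-irrefl refl r
  step 1 _ ((_ , ¬s) ∷ []) = ¬s (inj₁ (refl , refl))
  step ℓ@(suc (suc _)) rec p = forest (suc ℓ) (s≤s (s≤s (s≤s z≤n))) (f , f-inj , hom)
    where
    f : Fin (suc ℓ) → V
    f i = at p (toℕ i)

    shortcut : ∀ {i j} → i < j → j ≤ ℓ → at p i ≢ at p j
    shortcut {i} {j} i<j j≤ℓ eq = rec
      (ℕ.<-≤-trans (ℕ.+-monoˡ-< (ℓ ∸ j) i<j) (ℕ.≤-reflexive (ℕ.m+[n∸m]≡n j≤ℓ)))
      (take p (ℕ.≤-trans (ℕ.<⇒≤ i<j) j≤ℓ) ++
       subst (λ z → Walk R′ (ℓ ∸ j) z v) (sym eq) (drop p j≤ℓ))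

    f-inj : Injective _≡_ _≡_ f
    f-inj {i} {j} eq with ℕ.<-cmp (toℕ i) (toℕ j)
    ... | tri< i<j _ _ = ⊥-elim (shortcut i<j (Fin.toℕ≤pred[n] j) eq)
    ... | tri≈ _ i≡j _ = Fin.toℕ-injective i≡j
    ... | tri> _ _ j<i = ⊥-elim (shortcut j<i (Fin.toℕ≤pred[n] i) (sym eq))

    next : ∀ i j → Next (suc ℓ) i j → Adj (f i) (f j)
    next i j (inj₁ eq) = subst (λ k → Adj (f i) (at p k)) eq
      (proj₁ (at-step p (ℕ.≤-trans (ℕ.≤-reflexive eq) (Fin.toℕ≤pred[n] j))))
    next i j (inj₂ (eq₁ , eq₂)) rewrite ℕ.suc-injective eq₁ | eq₂ | at-first p | at-last p = adj-sym r

    hom : ∀ i j → Graph.Adj (C (suc ℓ)) i j → Adj (f i) (f j)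
    hom i j (_ , inj₁ nx) = next i j nx
    hom i j (_ , inj₂ nx) = adj-sym (next j i nx)

-- Graphs of large girth and chromatic number

sum-mono : {f h : Fin n → ℕ} → (∀ i → f i ≤ h i) → sum f ≤ sum h
sum-mono {zero}  f≤h = z≤n
sum-mono {suc n} f≤h = ℕ.+-mono-≤ (f≤h zero) (sum-mono (f≤h ∘ suc))

sum-upper : ∀ {b} {f : Fin n → ℕ} → (∀ i → f i ≤ b) → sum f ≤ n * b
sum-upper {zero}  f≤b = z≤n
sum-upper {suc n} f≤b = ℕ.+-mono-≤ (f≤b zero) (sum-upper (f≤b ∘ suc))

sum-lower : ∀ {b} {f : Fin n → ℕ} → (∀ i → b ≤ f i) → n * b ≤ sum f
sum-lower {zero}  b≤f = z≤n
sum-lower {suc n} b≤f = ℕ.+-mono-≤ (b≤f zero) (sum-lower (b≤f ∘ suc))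

argmax : (f : Fin (suc n) → ℕ) → ∃ λ i → ∀ j → f j ≤ f i
argmax {zero} f = zero , λ { zero → ℕ.≤-refl }
argmax {suc n} f with argmax (f ∘ suc)
... | i , max with ℕ.≤-total (f zero) (f (suc i))
... | inj₁ le = suc i , λ { zero → le ; (suc j) → max j }
... | inj₂ ge = zero , λ { zero → ℕ.≤-refl ; (suc j) → ℕ.≤-trans (max j) ge }

above-average : .{{NonZero n}} → (f : Fin n → ℕ) → ∃ λ i → sum f ≤ n * f i
above-average {suc n} f with argmax f
... | i , max = i , sum-upper max

ind : Dec X → ℕ
ind (yes _) = 1
ind (no _)  = 0

ind-mono : (X → Y) → (x? : Dec X) (y? : Dec Y) → ind x? ≤ ind y?
ind-mono f (yes x) (yes _) = ℕ.≤-refl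
ind-mono f (yes x) (no ¬y) = ⊥-elim (¬y (f x))
ind-mono f (no _)  _       = z≤n

ind-× : (x? : Dec X) (y? : Dec Y) → ind (x? ×-dec y?) ≡ ind x? * ind y?
ind-× (yes _) (yes _) = refl
ind-× (yes _) (no _)  = refl
ind-× (no _)  _       = refl

ind-⊎ : (x? : Dec X) (y? : Dec Y) → ind (x? ⊎-dec y?) ≤ ind x? + ind y?
ind-⊎ (yes _) y?      = s≤s z≤n
ind-⊎ (no _)  (yes _) = ℕ.≤-refl
ind-⊎ (no _)  (no _)  = ℕ.≤-refl

# : U.Decidable {A = Fin n} P → ℕ
# P? = sum (ind ∘ P?)

#-mono : (P? : U.Decidable P) (Q? : U.Decidable Q) → (∀ i → P i → Q i) → # P? ≤ # Q?
#-mono P? Q? f = sum-mono λ i → ind-mono (f i) (P? i) (Q? i)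

#-pos : (P? : U.Decidable P) → 0 < # P? → ∃ P
#-pos {zero}  P? ()
#-pos {suc n} P? pos with P? zero
... | yes p = zero , p
... | no _ with #-pos (P? ∘ suc) pos
... | i , p = suc i , p

ind≤# : (P? : U.Decidable P) → ∀ i → ind (P? i) ≤ # P?
ind≤# P? zero    = ℕ.m≤m+n _ _
ind≤# P? (suc i) = ℕ.≤-trans (ind≤# (P? ∘ suc) i) (ℕ.m≤n+m _ _)

ind-any : (P? : U.Decidable P) → ind (Fin.any? P?) ≤ # P?
ind-any P? with Fin.any? P?
... | no _        = z≤n
... | yes (i , p) with P? i | ind≤# P? i
...   | yes _ | le = le
...   | no ¬p | _  = ⊥-elim (¬p p)

#-point : (x : Fin n) → # (λ y → y Fin.≟ x) ≤ 1
#-point {suc n} zero    = ℕ.+-monoʳ-≤ 1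
  (ℕ.≤-trans (sum-upper {n} {0} λ i → ℕ.≤-refl) (ℕ.≤-reflexive (ℕ.*-zeroʳ n)))
#-point {suc n} (suc x) =
  ℕ.≤-trans (#-mono _ (λ y → y Fin.≟ x) λ i → Fin.suc-injective) (#-point x)

#-fibres : (P? : U.Decidable P) (f : Fin n → Fin m) →
           # P? ≤ sum λ a → # λ x → P? x ×-dec (a Fin.≟ f x)
#-fibres P? f = ℕ.≤-trans (sum-mono fibre) (ℕ.≤-reflexive (∑-comm λ x a → ind (P? x ×-dec (a Fin.≟ f x))))
  where
  fibre : ∀ x → ind (P? x) ≤ sum λ a → ind (P? x ×-dec (a Fin.≟ f x))
  fibre x with ind≤# (λ a → P? x ×-dec (a Fin.≟ f x)) (f x)
  ... | le with P? x | f x Fin.≟ f x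
  ... | yes _ | yes _ = le
  ... | yes _ | no ¬r = ⊥-elim (¬r refl)
  ... | no _  | _     = z≤n

-- Double counting of colourings and pairs

module Averaging {N n} {P : Pred (Fin N) 0ℓ} (P? : U.Decidable P)
  {Q : Fin N → Fin n → Fin n → Set} (Q? : ∀ c x y → Dec (Q c x y))
  .{{_ : NonZero n}} {D : ℕ}
  (dense : ∀ c → n * n ≤ D * (sum λ x → sum λ y → ind (Q? c x y))) where

  hits : Fin n → Fin n → ℕ
  hits x y = # λ c → P? c ×-dec Q? c x y

  total : sum (λ x → sum (hits x)) ≡ sum λ c → ind (P? c) * (sum λ x → sum λ y → ind (Q? c x y))
  total = begin
    (sum λ x → sum λ y → sum λ c → ind (P? c ×-dec Q? c x y))
      ≡⟨ sum-cong-≗ (λ x → ∑-comm λ y c → ind (P? c ×-dec Q? c x y)) ⟩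
    (sum λ x → sum λ c → sum λ y → ind (P? c ×-dec Q? c x y))
      ≡⟨ ∑-comm (λ x c → sum λ y → ind (P? c ×-dec Q? c x y)) ⟩
    (sum λ c → sum λ x → sum λ y → ind (P? c ×-dec Q? c x y))
      ≡⟨ sum-cong-≗ (λ c → sum-cong-≗ λ x → trans
           (sum-cong-≗ λ y → ind-× (P? c) (Q? c x y))
           (sym (*-distribˡ-sum (ind (P? c)) λ y → ind (Q? c x y)))) ⟩
    (sum λ c → sum λ x → ind (P? c) * sum λ y → ind (Q? c x y))
      ≡⟨ sum-cong-≗ (λ c → sym (*-distribˡ-sum (ind (P? c)) λ x → sum λ y → ind (Q? c x y))) ⟩
    (sum λ c → ind (P? c) * (sum λ x → sum λ y → ind (Q? c x y))) ∎
    where open ≡-Reasoning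

  -- Every `c` in `P` contributes at least `n² / D` pairs, so an average pair is hit by at least
  -- `# P? / D` of them. The pair is found as the best cell of the best row, and the factor `n * n`
  -- clears the denominators.
  frequent-pair : ∃₂ λ x y → # P? ≤ D * hits x y
  frequent-pair with above-average (λ x → sum (hits x))
  ... | x , row with above-average (hits x)
  ... | y , cell = x , y , ℕ.*-cancelˡ-≤ (n * n) {{ℕ.m*n≢0 n n}} (begin
    n * n * # P?                   ≡⟨ ℕ.*-comm (n * n) _ ⟩
    # P? * (n * n)                 ≡⟨ *-distribʳ-sum (n * n) (ind ∘ P?) ⟩
    (sum λ c → ind (P? c) * (n * n)) ≤⟨ sum-mono (λ c → ℕ.*-monoʳ-≤ (ind (P? c)) (dense c)) ⟩
    (sum λ c → ind (P? c) * (D * q c)) ≡⟨ sum-cong-≗ (λ c → swap* (ind (P? c)) D (q c)) ⟩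
    (sum λ c → D * (ind (P? c) * q c)) ≡⟨ *-distribˡ-sum D (λ c → ind (P? c) * q c) ⟨
    D * (sum λ c → ind (P? c) * q c) ≡⟨ cong (D *_) total ⟨
    D * sum (λ x → sum (hits x))   ≤⟨ ℕ.*-monoʳ-≤ D (ℕ.≤-trans row (ℕ.*-monoʳ-≤ n cell)) ⟩
    D * (n * (n * hits x y))       ≡⟨ regroup D n (hits x y) ⟩
    n * n * (D * hits x y)         ∎)
    where
    open ℕ.≤-Reasoning
    q : Fin N → ℕ
    q c = sum λ x → sum λ y → ind (Q? c x y)
    swap* : ∀ a b c → a * (b * c) ≡ b * (a * c)
    swap* = solve-∀
    regroup : ∀ a b c → a * (b * (b * c)) ≡ b * b * (a * c)
    regroup = solve-∀

-- Distance at most `g`, as `g` steps each of which may stand still. In this form it is decided by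
-- search over the next vertex.
Near : Rel (Fin n) 0ℓ → ℕ → Rel (Fin n) 0ℓ
Near R zero    x y = y ≡ x
Near R (suc g) x y = ∃ λ z → (z ≡ x ⊎ R x z) × Near R g z y

near? : {R : Rel (Fin n) 0ℓ} → Decidable R → ∀ g → Decidable (Near R g)
near? R? zero    x y = y Fin.≟ x
near? R? (suc g) x y = Fin.any? λ z → ((z Fin.≟ x) ⊎-dec R? x z) ×-dec near? R? g z y

walk-near : {R : Rel (Fin n) 0ℓ} {x y : Fin n} → ℓ ≤ g → Walk R ℓ x y → Near R g x y
walk-near {g = zero}  z≤n       []      = refl
walk-near {g = suc g} z≤n       []      = _ , inj₁ refl , walk-near {g = g} z≤n []
walk-near {g = suc g} (s≤s ℓ≤g) (r ∷ p) = _ , inj₂ r , walk-near ℓ≤g p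

-- The ball of radius `g + 1` around `x` is covered by the balls of radius `g` around `x` and its at
-- most `Δ` neighbours.
ball-size : {R : Rel (Fin n) 0ℓ} (R? : Decidable R) {Δ : ℕ} → (∀ x → # (R? x) ≤ Δ) →
            ∀ g x → # (near? R? g x) ≤ suc Δ ^ g
ball-size R? deg≤ zero x = #-point x
ball-size {n} R? {Δ} deg≤ (suc g) x = begin
  # (near? R? (suc g) x)
    ≤⟨ sum-mono (λ y → ind-any λ z → q? z ×-dec near? R? g z y) ⟩
  (sum λ y → sum λ z → ind (q? z ×-dec near? R? g z y))
    ≡⟨ ∑-comm (λ y z → ind (q? z ×-dec near? R? g z y)) ⟩
  (sum λ z → sum λ y → ind (q? z ×-dec near? R? g z y))
    ≡⟨ sum-cong-≗ (λ z → trans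
         (sum-cong-≗ λ y → ind-× (q? z) (near? R? g z y))
         (sym (*-distribˡ-sum (ind (q? z)) λ y → ind (near? R? g z y)))) ⟩
  (sum λ z → ind (q? z) * # (near? R? g z))
    ≤⟨ sum-mono (λ z → ℕ.*-monoʳ-≤ (ind (q? z)) (ball-size R? deg≤ g z)) ⟩
  (sum λ z → ind (q? z) * suc Δ ^ g)
    ≡⟨ *-distribʳ-sum (suc Δ ^ g) (ind ∘ q?) ⟨
  # q? * suc Δ ^ g
    ≤⟨ ℕ.*-monoˡ-≤ (suc Δ ^ g) (begin
         # q? ≤⟨ sum-mono (λ z → ind-⊎ (z Fin.≟ x) (R? x z)) ⟩
         (sum λ z → ind (z Fin.≟ x) + ind (R? x z))
           ≡⟨ ∑-distrib-+ (λ z → ind (z Fin.≟ x)) (λ z → ind (R? x z)) ⟩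
         # (λ z → z Fin.≟ x) + # (R? x) ≤⟨ ℕ.+-mono-≤ (#-point x) (deg≤ x) ⟩
         suc Δ ∎) ⟩
  suc Δ * suc Δ ^ g ∎
  where
  open ℕ.≤-Reasoning
  q? : U.Decidable _
  q? z = (z Fin.≟ x) ⊎-dec R? x z

-- Graphs on a fixed vertex set, and adding an edge

record GraphOn (n : ℕ) : Set₁ where
  field
    Adj        : Rel (Fin n) 0ℓ
    adj?       : Decidable Adj
    adj-sym    : Symmetric Adj
    adj-irrefl : Irreflexive _≡_ Adj

  degree : Fin n → ℕ
  degree v = # (adj? v)

  graph : Graph
  graph = record
    { order = n ; Adj = Adj ; adj? = adj?
    ; adj-sym    = λ {u} {v} → adj-sym {u} {v}
    ; adj-irrefl = λ {u} {v} → adj-irrefl {u} {v} }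

empty : ∀ n → GraphOn n
empty n = record { Adj = λ _ _ → ⊥ ; adj? = λ _ _ → no id ; adj-sym = λ () ; adj-irrefl = λ _ () }

samePair? : (u v a b : Fin n) → Dec (SamePair u v a b)
samePair? u v a b = ((a Fin.≟ u) ×-dec (b Fin.≟ v)) ⊎-dec ((a Fin.≟ v) ×-dec (b Fin.≟ u))

addEdge : GraphOn n → {x y : Fin n} → x ≢ y → GraphOn n
addEdge G {x} {y} x≢y = record
  { Adj        = Adj ∪⟨ x , y ⟩
  ; adj?       = λ u v → adj? u v ⊎-dec samePair? x y u v
  ; adj-sym    = λ { (inj₁ r) → inj₁ (adj-sym r) ; (inj₂ s) → inj₂ (samePair-sym s) }
  ; adj-irrefl = λ { refl (inj₁ r) → adj-irrefl refl r
                   ; refl (inj₂ (inj₁ (refl , x≡y))) → x≢y x≡y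
                   ; refl (inj₂ (inj₂ (refl , y≡x))) → x≢y (sym y≡x) }
  }
  where open GraphOn G

open GraphOn using (degree; graph)

-- Only an upper bound, since `x` and `y` may be adjacent already.
degree-addEdge : (G : GraphOn n) {x y : Fin n} (x≢y : x ≢ y) → ∀ v →
  degree (addEdge G x≢y) v ≤ degree G v + (ind (v Fin.≟ x) + ind (v Fin.≟ y))
degree-addEdge G {x} {y} x≢y v = begin
  degree (addEdge G x≢y) v
    ≤⟨ sum-mono (λ w → ind-⊎ (adj? v w) (samePair? x y v w)) ⟩
  (sum λ w → ind (adj? v w) + ind (samePair? x y v w))
    ≡⟨ ∑-distrib-+ (λ w → ind (adj? v w)) (λ w → ind (samePair? x y v w)) ⟩
  degree G v + # (samePair? x y v)
    ≤⟨ ℕ.+-monoʳ-≤ (degree G v) (begin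
      # (samePair? x y v)
        ≤⟨ sum-mono (λ w → ind-⊎ ((v Fin.≟ x) ×-dec (w Fin.≟ y)) ((v Fin.≟ y) ×-dec (w Fin.≟ x))) ⟩
      (sum λ w → ind ((v Fin.≟ x) ×-dec (w Fin.≟ y)) + ind ((v Fin.≟ y) ×-dec (w Fin.≟ x)))
        ≡⟨ ∑-distrib-+ (λ w → ind ((v Fin.≟ x) ×-dec (w Fin.≟ y)))
                       (λ w → ind ((v Fin.≟ y) ×-dec (w Fin.≟ x))) ⟩
      # (λ w → (v Fin.≟ x) ×-dec (w Fin.≟ y)) + # (λ w → (v Fin.≟ y) ×-dec (w Fin.≟ x))
        ≤⟨ ℕ.+-mono-≤ (new x y) (new y x) ⟩
      ind (v Fin.≟ x) + ind (v Fin.≟ y) ∎) ⟩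
  degree G v + (ind (v Fin.≟ x) + ind (v Fin.≟ y)) ∎
  where
  open ℕ.≤-Reasoning
  open GraphOn G using (adj?)
  new : ∀ a b → # (λ w → (v Fin.≟ a) ×-dec (w Fin.≟ b)) ≤ ind (v Fin.≟ a)
  new a b = begin
    # (λ w → (v Fin.≟ a) ×-dec (w Fin.≟ b)) ≡⟨ sum-cong-≗ (λ w → ind-× (v Fin.≟ a) (w Fin.≟ b)) ⟩
    (sum λ w → ind (v Fin.≟ a) * ind (w Fin.≟ b))
      ≡⟨ *-distribˡ-sum (ind (v Fin.≟ a)) (λ w → ind (w Fin.≟ b)) ⟨
    ind (v Fin.≟ a) * # (λ w → w Fin.≟ b) ≤⟨ ℕ.*-monoʳ-≤ (ind (v Fin.≟ a)) (#-point b) ⟩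
    ind (v Fin.≟ a) * 1 ≡⟨ ℕ.*-identityʳ _ ⟩
    ind (v Fin.≟ a) ∎

degrees-addEdge : (G : GraphOn n) {x y : Fin n} (x≢y : x ≢ y) →
  sum (degree (addEdge G x≢y)) ≤ 2 + sum (degree G)
degrees-addEdge G {x} {y} x≢y = begin
  sum (degree (addEdge G x≢y))
    ≤⟨ sum-mono (degree-addEdge G x≢y) ⟩
  (sum λ v → degree G v + (ind (v Fin.≟ x) + ind (v Fin.≟ y)))
    ≡⟨ ∑-distrib-+ (degree G) (λ v → ind (v Fin.≟ x) + ind (v Fin.≟ y)) ⟩
  sum (degree G) + (sum λ v → ind (v Fin.≟ x) + ind (v Fin.≟ y))
    ≡⟨ cong (sum (degree G) +_) (∑-distrib-+ (λ v → ind (v Fin.≟ x)) (λ v → ind (v Fin.≟ y))) ⟩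
  sum (degree G) + (# (λ v → v Fin.≟ x) + # (λ v → v Fin.≟ y))
    ≤⟨ ℕ.+-monoʳ-≤ (sum (degree G)) (ℕ.+-mono-≤ (#-point x) (#-point y)) ⟩
  sum (degree G) + 2
    ≡⟨ ℕ.+-comm _ 2 ⟩
  2 + sum (degree G) ∎
  where open ℕ.≤-Reasoning

degree-addEdge-bounded : (G : GraphOn n) {x y : Fin n} (x≢y : x ≢ y) {Δ : ℕ} →
  (∀ v → degree G v ≤ Δ) → degree G x < Δ → degree G y < Δ → ∀ v → degree (addEdge G x≢y) v ≤ Δ
degree-addEdge-bounded G {x} {y} x≢y {Δ} deg≤ dx dy v = ℕ.≤-trans (degree-addEdge G x≢y v) lemma
  where
  lemma : degree G v + (ind (v Fin.≟ x) + ind (v Fin.≟ y)) ≤ Δ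
  lemma with v Fin.≟ x | v Fin.≟ y
  ... | yes refl | yes x≡y  = ⊥-elim (x≢y x≡y)
  ... | yes refl | no _     = ℕ.≤-trans (ℕ.≤-reflexive (ℕ.+-comm (degree G x) 1)) dx
  ... | no _     | yes refl = ℕ.≤-trans (ℕ.≤-reflexive (ℕ.+-comm (degree G y) 1)) dy
  ... | no _     | no _     = ℕ.≤-trans (ℕ.≤-reflexive (ℕ.+-identityʳ _)) (deg≤ v)

-- Markov's inequality: a vertex with `f v < Δ` contributes `Δ` to the first term, any other at
-- least `Δ` to `sum f`.
unsaturated : (Δ : ℕ) (f : Fin n → ℕ) → n * Δ ≤ # (λ v → f v ℕ.<? Δ) * Δ + sum f
unsaturated {n} Δ f = begin
  n * Δ ≤⟨ sum-lower lower ⟩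
  (sum λ v → ind (f v ℕ.<? Δ) * Δ + f v) ≡⟨ ∑-distrib-+ (λ v → ind (f v ℕ.<? Δ) * Δ) f ⟩
  (sum λ v → ind (f v ℕ.<? Δ) * Δ) + sum f ≡⟨ cong (_+ sum f) (*-distribʳ-sum Δ (λ v → ind (f v ℕ.<? Δ))) ⟨
  # (λ v → f v ℕ.<? Δ) * Δ + sum f ∎
  where
  open ℕ.≤-Reasoning
  lower : ∀ v → Δ ≤ ind (f v ℕ.<? Δ) * Δ + f v
  lower v with f v ℕ.<? Δ
  ... | yes _   = ℕ.≤-trans (ℕ.m≤m+n Δ 0) (ℕ.m≤m+n _ (f v))
  ... | no f≮Δ = ℕ.≮⇒≥ f≮Δ

-- Counting proper colourings and monochromatic pairs

Proper : Rel (Fin n) 0ℓ → (Fin n → X) → Set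
Proper R f = ∀ u v → R u v → f u ≢ f v

proper? : {R : Rel (Fin n) 0ℓ} → Decidable R → (f : Fin n → Fin m) → Dec (Proper R f)
proper? R? f = Fin.all? λ u → Fin.all? λ v → R? u v →-dec ¬? (f u Fin.≟ f v)

-- Colourings are enumerated by their codes in `Fin (m ^ n)`, so that the counting tools for
-- vertices apply to them too.
colorings : (m : ℕ) → GraphOn n → ℕ
colorings {n} m G = # {m ^ n} λ c → proper? (GraphOn.adj? G) (finToFun c)

-- The two sets counted on the left are disjoint parts of the proper colourings of `G`, because the
-- new edge excludes every colouring in `Q`.
colorings-addEdge : (m : ℕ) (G : GraphOn n) {x y : Fin n} (x≢y : x ≢ y)
  {Q : Pred (Fin (m ^ n)) 0ℓ} (Q? : U.Decidable Q) → (∀ c → Q c → finToFun c x ≡ finToFun c y) →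
  colorings m (addEdge G x≢y) + # (λ c → proper? (GraphOn.adj? G) (finToFun c) ×-dec Q? c) ≤ colorings m G
colorings-addEdge {n} m G {x} {y} x≢y Q? mono = begin
  # new? + # bad? ≡⟨ ∑-distrib-+ (ind ∘ new?) (ind ∘ bad?) ⟨
  (sum λ c → ind (new? c) + ind (bad? c)) ≤⟨ sum-mono disjoint ⟩
  # old? ∎
  where
  open ℕ.≤-Reasoning
  new? = λ (c : Fin (m ^ n)) → proper? (GraphOn.adj? (addEdge G x≢y)) (finToFun c)
  old? = λ (c : Fin (m ^ n)) → proper? (GraphOn.adj? G) (finToFun c)
  bad? = λ c → old? c ×-dec Q? c
  disjoint : ∀ c → ind (new? c) + ind (bad? c) ≤ ind (old? c)
  disjoint c with new? c | old? c | Q? c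
  ... | yes p | _     | yes q = ⊥-elim (p x y (inj₂ (inj₁ (refl , refl))) (mono c q))
  ... | yes p | no ¬o | no _  = ⊥-elim (¬o λ u v r → p u v (inj₁ r))
  ... | yes _ | yes _ | no _  = ℕ.≤-refl
  ... | no _  | yes _ | yes _ = ℕ.≤-refl
  ... | no _  | yes _ | no _  = z≤n
  ... | no _  | no _  | _     = z≤n

module _ {R : Rel (Fin n) 0ℓ} (R? : Decidable R) {Δ g q : ℕ} .{{_ : NonZero q}}
  (deg≤ : ∀ x → # (R? x) ≤ Δ) {U : Pred (Fin n) 0ℓ} (U? : U.Decidable U)
  (n≤2u : n ≤ 2 * # U?) (ball≤n : 4 * q * suc Δ ^ g ≤ n) (f : Fin n → Fin q) where

  FarMono : Fin n → Fin n → Set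
  FarMono x y = (U x × U y × ¬ Near R g x y) × f x ≡ f y

  farMono? : Decidable FarMono
  farMono? x y = (U? x ×-dec U? y ×-dec ¬? (near? R? g x y)) ×-dec (f x Fin.≟ f y)

  -- Let `a` be the colour used most often on `U`, on `s ≥ n / (2 q)` of its vertices. A ball has at
  -- most `b ≤ s / 2` vertices, so each of these `s` vertices is far from at least `s / 2` of them.
  -- This gives `s² / 2 ≥ n² / (8 q²)` ordered pairs.
  many-farMono : n * n ≤ 8 * q * q * (sum λ x → sum λ y → ind (farMono? x y))
  many-farMono with above-average (λ a → # λ x → U? x ×-dec (a Fin.≟ f x))
  ... | a , u≤qs = begin
    n * n ≤⟨ ℕ.*-mono-≤ n≤2qs n≤2qs ⟩
    2 * q * s * (2 * q * s) ≡⟨ e₁ q s ⟩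
    4 * q * q * (s * s) ≤⟨ ℕ.*-monoʳ-≤ (4 * q * q) (ℕ.*-monoʳ-≤ s s≤2r) ⟩
    4 * q * q * (s * (2 * (s ∸ b))) ≡⟨ e₂ q s (s ∸ b) ⟩
    8 * q * q * (s * (s ∸ b)) ≤⟨ ℕ.*-monoʳ-≤ (8 * q * q) rows ⟩
    8 * q * q * (sum λ x → sum λ y → ind (farMono? x y)) ∎
    where
    open ℕ.≤-Reasoning
    W? = λ x → U? x ×-dec (a Fin.≟ f x)
    s = # W?
    b = suc Δ ^ g
    e₁ : ∀ q s → 2 * q * s * (2 * q * s) ≡ 4 * q * q * (s * s)
    e₁ = solve-∀
    e₂ : ∀ q s r → 4 * q * q * (s * (2 * r)) ≡ 8 * q * q * (s * r)
    e₂ = solve-∀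
    e₃ : ∀ q s → 4 * q * s ≡ 2 * q * (2 * s)
    e₃ = solve-∀

    n≤2qs : n ≤ 2 * q * s
    n≤2qs = begin
      n ≤⟨ n≤2u ⟩
      2 * # U? ≤⟨ ℕ.*-monoʳ-≤ 2 (ℕ.≤-trans (#-fibres U? f) u≤qs) ⟩
      2 * (q * s) ≡⟨ ℕ.*-assoc 2 q s ⟨
      2 * q * s ∎

    2b≤s : 2 * b ≤ s
    2b≤s = ℕ.*-cancelˡ-≤ (2 * q) {{ℕ.m*n≢0 2 q}} (begin
      2 * q * (2 * b) ≡⟨ e₃ q b ⟨
      4 * q * b ≤⟨ ball≤n ⟩
      n ≤⟨ n≤2qs ⟩
      2 * q * s ∎)

    s≤2r : s ≤ 2 * (s ∸ b)
    s≤2r = begin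
      s ≡⟨ ℕ.m+n∸n≡m s s ⟨
      s + s ∸ s ≤⟨ ℕ.∸-monoʳ-≤ (s + s) 2b≤s ⟩
      s + s ∸ 2 * b ≡⟨ cong (_∸ 2 * b) (cong (s +_) (sym (ℕ.+-identityʳ s))) ⟩
      2 * s ∸ 2 * b ≡⟨ ℕ.*-distribˡ-∸ 2 s b ⟨
      2 * (s ∸ b) ∎

    row : ∀ x → ind (W? x) * (s ∸ b) ≤ sum λ y → ind (farMono? x y)
    row x with W? x
    ... | no _ = z≤n
    ... | yes (ux , a≡fx) = begin
      1 * (s ∸ b) ≡⟨ ℕ.*-identityˡ _ ⟩
      s ∸ b ≤⟨ ℕ.m≤n+o⇒m∸n≤o s b split ⟩
      (sum λ y → ind (farMono? x y)) ∎
      where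
      cover : ∀ y → ind (W? y) ≤ ind (near? R? g x y) + ind (farMono? x y)
      cover y = ℕ.≤-trans
        (ind-mono {Y = Near R g x y ⊎ FarMono x y} dichotomy (W? y) (near? R? g x y ⊎-dec farMono? x y))
        (ind-⊎ (near? R? g x y) (farMono? x y))
        where
        dichotomy : U y × a ≡ f y → Near R g x y ⊎ FarMono x y
        dichotomy (uy , a≡fy) with near? R? g x y
        ... | yes nr = inj₁ nr
        ... | no ¬nr = inj₂ ((ux , uy , ¬nr) , trans (sym a≡fx) a≡fy)

      split : s ≤ b + sum λ y → ind (farMono? x y)
      split = begin
        s ≤⟨ sum-mono cover ⟩
        (sum λ y → ind (near? R? g x y) + ind (farMono? x y))
          ≡⟨ ∑-distrib-+ (λ y → ind (near? R? g x y)) (λ y → ind (farMono? x y)) ⟩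
        # (near? R? g x) + (sum λ y → ind (farMono? x y)) ≤⟨ ℕ.+-monoˡ-≤ _ (ball-size R? deg≤ g x) ⟩
        b + (sum λ y → ind (farMono? x y)) ∎

    rows : s * (s ∸ b) ≤ sum λ x → sum λ y → ind (farMono? x y)
    rows = begin
      s * (s ∸ b) ≡⟨ *-distribʳ-sum (s ∸ b) (ind ∘ W?) ⟩
      (sum λ x → ind (W? x) * (s ∸ b)) ≤⟨ sum-mono row ⟩
      (sum λ x → sum λ y → ind (farMono? x y)) ∎

-- Numerical estimates

-- Bernoulli's inequality `1 + k / d ≤ (1 + 1 / d) ^ k`, multiplied by `d ^ (k + 1)`.
bernoulli : ∀ d k → d ^ k * (d + k) ≤ d * suc d ^ k
bernoulli d zero    = ℕ.≤-reflexive (e d)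
  where e : ∀ d → 1 * (d + 0) ≡ d * 1
        e = solve-∀
bernoulli d (suc k) = begin
  d * d ^ k * (d + suc k) ≤⟨ ℕ.m≤m+n _ (d ^ k * k) ⟩
  d * d ^ k * (d + suc k) + d ^ k * k ≡⟨ e₁ d (d ^ k) k ⟩
  suc d * (d ^ k * (d + k)) ≤⟨ ℕ.*-monoʳ-≤ (suc d) (bernoulli d k) ⟩
  suc d * (d * suc d ^ k) ≡⟨ e₂ d (suc d ^ k) ⟩
  d * suc d ^ suc k ∎
  where
  open ℕ.≤-Reasoning
  e₁ : ∀ d p k → d * p * (d + suc k) + p * k ≡ suc d * (p * (d + k))
  e₁ = solve-∀
  e₂ : ∀ d p → suc d * (d * p) ≡ d * (suc d * p)
  e₂ = solve-∀

-- With `k = q * d`, Bernoulli's inequality yields `(1 + 1 / d) ^ k ≥ 1 + q`.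
exponential-gap : ∀ d q .{{_ : NonZero d}} → q * d ^ (q * d) < suc d ^ (q * d)
exponential-gap d q = ℕ.*-cancelˡ-≤ d (begin
  d * suc (q * p) ≤⟨ ℕ.*-monoʳ-≤ d (ℕ.+-monoˡ-≤ (q * p) (ℕ.m^n>0 d (q * d))) ⟩
  d * (p + q * p) ≡⟨ e d p q ⟩
  p * (d + q * d) ≤⟨ bernoulli d (q * d) ⟩
  d * suc d ^ (q * d) ∎)
  where
  open ℕ.≤-Reasoning
  p = d ^ (q * d)
  e : ∀ d p q → d * (p + q * p) ≡ p * (d + q * d)
  e = solve-∀

^-distribʳ-* : ∀ k a b → (a * b) ^ k ≡ a ^ k * b ^ k
^-distribʳ-* zero    a b = refl
^-distribʳ-* (suc k) a b = trans (cong (a * b *_) (^-distribʳ-* k a b)) (interchange a b (a ^ k) (b ^ k))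
  where
  interchange : ∀ a b c d → a * b * (c * d) ≡ a * c * (b * d)
  interchange = solve-∀

-- One more factor `d / D` in the bound on the number of colourings, with denominators cleared; `p`
-- and `r` stand for `D ^ t` and `d ^ t`.
decay : ∀ S′ S D d p r Q → S′ * D ≤ S * d → S * p ≤ Q * r → S′ * (D * p) ≤ Q * (d * r)
decay S′ S D d p r Q S′D≤Sd few = begin
  S′ * (D * p)  ≡⟨ ℕ.*-assoc S′ D p ⟨
  S′ * D * p    ≤⟨ ℕ.*-monoˡ-≤ p S′D≤Sd ⟩
  S * d * p     ≡⟨ e₁ S d p ⟩
  d * (S * p)   ≤⟨ ℕ.*-monoʳ-≤ d few ⟩
  d * (Q * r)   ≡⟨ e₂ d Q r ⟩
  Q * (d * r)   ∎
  where
  open ℕ.≤-Reasoning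
  e₁ : ∀ a b c → a * b * c ≡ b * (a * c)
  e₁ = solve-∀
  e₂ : ∀ a b c → a * (b * c) ≡ b * (a * c)
  e₂ = solve-∀

-- The greedy construction

module Greedy (q g d c Δ size : ℕ) .{{_ : NonZero q}} .{{_ : NonZero c}} .{{_ : NonZero size}}
  (D≡ : suc d ≡ 8 * q * q) (Δ≡ : Δ ≡ 4 * c) (balls : 4 * q * suc Δ ^ g ≤ size)
  (gap : q * d ^ c < suc d ^ c) where

  -- With `c` steps per vertex, the proportion `(d / D) ^ steps` of surviving colourings falls below
  -- `1 / q ^ size` by `gap`. The edges added meanwhile use up at most half of the total degree
  -- `size * Δ`, as `Δ = 4 * c`.
  D steps : ℕ
  D     = suc d
  steps = c * size

  record State (t : ℕ) : Set₁ where
    field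
      G       : GraphOn size
      girth   : GirthAbove g (GraphOn.Adj G)
      deg≤    : ∀ v → degree G v ≤ Δ
      degrees : sum (degree G) ≤ 2 * t
      few     : colorings q G * D ^ t ≤ q ^ size * d ^ t

  start : State 0
  start = record
    { G       = empty size
    ; girth   = λ ()
    ; deg≤    = λ v → no-degree v
    ; degrees = ℕ.≤-trans (sum-upper {size} {0} λ v → no-degree v) (ℕ.≤-reflexive (ℕ.*-zeroʳ size))
    ; few     = ℕ.*-monoˡ-≤ 1 (ℕ.≤-trans
        (sum-upper {q ^ size} {1} λ i → ind≤1 (proper? (GraphOn.adj? (empty size)) (finToFun i)))
        (ℕ.≤-reflexive (ℕ.*-identityʳ (q ^ size))))
    }
    where
    no-degree : ∀ {k} v → degree (empty size) v ≤ k
    no-degree v = ℕ.≤-trans (sum-upper {size} {0} λ _ → z≤n)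
                            (ℕ.≤-trans (ℕ.≤-reflexive (ℕ.*-zeroʳ size)) z≤n)
    ind≤1 : (x? : Dec X) → ind x? ≤ 1
    ind≤1 (yes _) = ℕ.≤-refl
    ind≤1 (no _)  = z≤n

  module Step {t : ℕ} (t<steps : t < steps) (s : State t) where
    open State s
    open GraphOn G using (Adj; adj?; adj-sym)

    U? : U.Decidable (λ v → degree G v < Δ)
    U? v = degree G v ℕ.<? Δ

    -- The degrees sum to at most `2 * c * size`, half of `size * Δ`; by `unsaturated`, the vertices
    -- of degree below `Δ` account for the other half.
    n≤2u : size ≤ 2 * # U?
    n≤2u = ℕ.+-cancelʳ-≤ size size (2 * # U?) (ℕ.*-cancelˡ-≤ (2 * c) {{ℕ.m*n≢0 2 c}} (begin
      2 * c * (size + size)         ≡⟨ trans (e₁ c size) (cong (size *_) (sym Δ≡)) ⟩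
      size * Δ                      ≤⟨ unsaturated Δ (degree G) ⟩
      # U? * Δ + sum (degree G)
        ≤⟨ ℕ.+-monoʳ-≤ (# U? * Δ) (ℕ.≤-trans degrees (ℕ.*-monoʳ-≤ 2 (ℕ.<⇒≤ t<steps))) ⟩
      # U? * Δ + 2 * steps
        ≡⟨ trans (cong (λ Δ → # U? * Δ + 2 * steps) Δ≡) (e₂ c size (# U?)) ⟩
      2 * c * (2 * # U? + size)     ∎))
      where
      open ℕ.≤-Reasoning
      e₁ : ∀ c n → 2 * c * (n + n) ≡ n * (4 * c)
      e₁ = solve-∀
      e₂ : ∀ c n u → u * (4 * c) + 2 * (c * n) ≡ 2 * c * (2 * u + n)
      e₂ = solve-∀

    proper-coloring? : U.Decidable (λ (i : Fin (q ^ size)) → Proper Adj (finToFun i))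
    proper-coloring? i = proper? adj? (finToFun i)

    Q? : ∀ (i : Fin (q ^ size)) x y → Dec _
    Q? i = farMono? adj? {Δ} {g} deg≤ U? n≤2u balls (finToFun i)

    open Averaging proper-coloring? Q? {D = D} (λ i → ℕ.≤-trans
      (many-farMono adj? {Δ} {g} deg≤ U? n≤2u balls (finToFun i))
      (ℕ.*-monoˡ-≤ _ (ℕ.≤-reflexive (sym D≡))))

    module _ (x y : Fin size) (freq : colorings q G ≤ D * hits x y)
      (ux : degree G x < Δ) (uy : degree G y < Δ) (far : ¬ Near Adj g x y) where

      x≢y : x ≢ y
      x≢y refl = far (walk-near {ℓ = 0} z≤n [])

      S S′ : ℕ
      S  = colorings q G
      S′ = colorings q (addEdge G x≢y)

      -- The new edge destroys at least `S / D` of the `S` colourings.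
      S′D≤Sd : S′ * D ≤ S * d
      S′D≤Sd = ℕ.+-cancelʳ-≤ S (S′ * D) (S * d) (begin
        S′ * D + S              ≤⟨ ℕ.+-monoʳ-≤ (S′ * D) freq ⟩
        S′ * D + D * hits x y   ≡⟨ cong (S′ * D +_) (ℕ.*-comm D (hits x y)) ⟩
        S′ * D + hits x y * D   ≡⟨ ℕ.*-distribʳ-+ D S′ (hits x y) ⟨
        (S′ + hits x y) * D
          ≤⟨ ℕ.*-monoˡ-≤ D (colorings-addEdge q G x≢y (λ i → Q? i x y) λ _ → proj₂) ⟩
        S * D                   ≡⟨ ℕ.*-suc S d ⟩
        S + S * d               ≡⟨ ℕ.+-comm S (S * d) ⟩
        S * d + S               ∎)
        where open ℕ.≤-Reasoning

      extend : State (suc t)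
      extend = record
        { G       = addEdge G x≢y
        ; girth   = ∪-girth adj-sym girth λ ℓ≤g p → far (walk-near ℓ≤g p)
        ; deg≤    = degree-addEdge-bounded G x≢y deg≤ ux uy
        ; degrees = ℕ.≤-trans (degrees-addEdge G x≢y)
                      (ℕ.≤-trans (ℕ.+-monoʳ-≤ 2 degrees) (ℕ.≤-reflexive (sym (ℕ.*-suc 2 t))))
        ; few     = decay S′ S D d (D ^ t) (d ^ t) (q ^ size) S′D≤Sd few
        }

    good-pair : 0 < colorings q G → ∃₂ λ x y → colorings q G ≤ D * hits x y × 0 < hits x y
    good-pair 0<S = let x , y , freq = frequent-pair in
      x , y , freq , ℕ.n≢0⇒n>0 λ hits≡0 → ℕ.<⇒≱ 0<S (ℕ.≤-trans freq
        (ℕ.≤-reflexive (trans (cong (D *_) hits≡0) (ℕ.*-zeroʳ D))))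

    next : State (suc t)
    next = advance (0 ℕ.<? colorings q G)
      where
      advance : Dec (0 < colorings q G) → State (suc t)
      advance (yes 0<S) =
        let x , y , freq , 0<hits = good-pair 0<S
            -- The conditions on degree and distance do not depend on the colouring, so any single
            -- colouring counted by `hits x y` certifies them.
            _ , _ , (ux , uy , far) , _ = #-pos (λ i → proper-coloring? i ×-dec Q? i x y) 0<hits
        in extend x y freq ux uy far
      -- No proper colouring is left: the graph is kept, and the left side of `few` is 0.
      advance (no S≯0) = record
        { G       = G
        ; girth   = girth
        ; deg≤    = deg≤
        ; degrees = ℕ.≤-trans degrees (ℕ.*-monoʳ-≤ 2 (ℕ.n≤1+n t))
        ; few     = subst (λ S → S * D ^ suc t ≤ q ^ size * d ^ suc t) 
                            (sym (ℕ.n≤0⇒n≡0 (ℕ.≮⇒≥ S≯0))) z≤n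
        }

  run : ∀ t → t ≤ steps → State t
  run zero    _  = start
  run (suc t) t< = Step.next t< (run t (ℕ.<⇒≤ t<))

  open State (run steps ℕ.≤-refl) public using (G; girth; few)

  -- A proper colouring would make the count at least 1, whereas `few` bounds it by the power
  -- `(q * d ^ c / D ^ c) ^ size`, whose base is below 1 by `gap`.
  no-coloring : (f : Fin size → Fin q) → ¬ Proper (GraphOn.Adj G) f
  no-coloring f proper = ℕ.<-irrefl refl (begin-strict
    D ^ steps                    ≡⟨ ℕ.*-identityˡ (D ^ steps) ⟨
    1 * D ^ steps                ≤⟨ ℕ.*-monoˡ-≤ (D ^ steps) some ⟩
    colorings q G * D ^ steps    ≤⟨ few ⟩
    q ^ size * d ^ steps         ≡⟨ cong (q ^ size *_) (sym (ℕ.^-*-assoc d c size)) ⟩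
    q ^ size * (d ^ c) ^ size    ≡⟨ ^-distribʳ-* size q (d ^ c) ⟨
    (q * d ^ c) ^ size           <⟨ ℕ.^-monoˡ-< size gap ⟩
    (D ^ c) ^ size               ≡⟨ ℕ.^-*-assoc D c size ⟩
    D ^ steps                    ∎)
    where
    open ℕ.≤-Reasoning
    encoded : Proper (GraphOn.Adj G) (finToFun (funToFin f))
    encoded u v r eq = proper u v r (trans (sym (Fin.finToFun-funToFin f u))
                                      (trans eq (Fin.finToFun-funToFin f v)))
    some : 1 ≤ colorings q G
    some with proper? (GraphOn.adj? G) (finToFun (funToFin f))
            | ind≤# (λ i → proper? (GraphOn.adj? G) (finToFun i)) (funToFin f)
    ... | yes _ | le = le
    ... | no ¬p | _  = ⊥-elim (¬p encoded)

large-girth-and-chromatic : (q g : ℕ) → .{{NonZero q}} → ∃₂ λ n (G : GraphOn n) →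
  GirthAbove g (GraphOn.Adj G) × (∀ (f : Fin n → Fin q) → ¬ Proper (GraphOn.Adj G) f)
large-girth-and-chromatic q g = size , G , girth , no-coloring
  where
  -- `d + 1` is the factor in `many-farMono`, `c` the exponent in `exponential-gap`, and `size` the
  -- least value that the ball condition allows for `Δ = 4 * c`.
  d = pred (8 * q * q)
  c = q * d
  size = 4 * q * suc (4 * c) ^ g

  D≡ : suc d ≡ 8 * q * q
  D≡ = ℕ.suc-pred (8 * q * q) {{ℕ.m*n≢0 (8 * q) q {{ℕ.m*n≢0 8 q}}}}

  instance
    d≢0 : NonZero d
    d≢0 = >-nonZero (s≤s⁻¹ (ℕ.≤-trans (s≤s (s≤s z≤n)) (ℕ.≤-trans
      (ℕ.*-mono-≤ (ℕ.m≤m*n 8 q) (>-nonZero⁻¹ q)) (ℕ.≤-reflexive (sym D≡)))))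
    c≢0 : NonZero c
    c≢0 = ℕ.m*n≢0 q d
    size≢0 : NonZero size
    size≢0 = ℕ.m*n≢0 (4 * q) (suc (4 * c) ^ g) {{ℕ.m*n≢0 4 q}} {{ℕ.m^n≢0 (suc (4 * c)) g}}

  open Greedy q g d c (4 * c) size D≡ refl ℕ.≤-refl (exponential-gap d q) using (G; girth; no-coloring)

-- Subdivisions

unique-lookup : {xs : List X} → Unique xs → Injective _≡_ _≡_ (lookup xs)
unique-lookup (_ ∷ _)  {zero}  {zero}  _  = refl
unique-lookup (x∉ ∷ _) {zero}  {suc j} eq = ⊥-elim (All.lookup x∉ (∈-lookup j) eq)
unique-lookup (x∉ ∷ _) {suc i} {zero}  eq = ⊥-elim (All.lookup x∉ (∈-lookup i) (sym eq))
unique-lookup (_ ∷ un) {suc i} {suc j} eq = cong suc (unique-lookup un eq)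

module Subdivision (G : Graph) where
  open Graph G public

  Edge : Set
  Edge = Fin (length (edges G))

  end₁ end₂ : Edge → V
  end₁ e = proj₁ (lookup (edges G) e)
  end₂ e = proj₂ (lookup (edges G) e)

  Joins : Edge → V → V → Set
  Joins e = SamePair (end₁ e) (end₂ e)

  private
    edge? : ∀ ((u , v) : V × V) → Dec (toℕ u < toℕ v × Adj u v)
    edge? (u , v) = (u Fin.<? v) ×-dec adj? u v

  ends-edge : ∀ e → toℕ (end₁ e) < toℕ (end₂ e) × Adj (end₁ e) (end₂ e)
  ends-edge e = proj₂ (∈-filter⁻ edge? {xs = cartesianProduct (allFin order) (allFin order)}
                         (∈-lookup {xs = edges G} e))

  joins-adj : ∀ {e u v} → Joins e u v → Adj u v
  joins-adj {e} (inj₁ (refl , refl)) = proj₂ (ends-edge e)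
  joins-adj {e} (inj₂ (refl , refl)) = adj-sym (proj₂ (ends-edge e))

  private
    listed : ∀ {u v} → toℕ u < toℕ v → Adj u v → ∃ λ e → (u , v) ≡ lookup (edges G) e
    listed {u} {v} u<v r = Any.index p , lookup-index p
      where
      p : (u , v) ∈ edges G
      p = ∈-filter⁺ edge? (∈-cartesianProduct⁺ (∈-allFin u) (∈-allFin v)) (u<v , r)

  edge-joining : ∀ {u v} → Adj u v → ∃ λ e → Joins e u v
  edge-joining {u} {v} r with ℕ.<-cmp (toℕ u) (toℕ v)
  ... | tri< u<v _ _ = let e , eq = listed u<v r in
                       e , inj₁ (cong proj₁ eq , cong proj₂ eq)
  ... | tri≈ _ u≡v _ = ⊥-elim (adj-irrefl (Fin.toℕ-injective u≡v) r)
  ... | tri> _ _ v<u = let e , eq = listed v<u (adj-sym r) in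
                       e , inj₂ (cong proj₂ eq , cong proj₁ eq)

  lookup-injective : ∀ {e e′} → lookup (edges G) e ≡ lookup (edges G) e′ → e ≡ e′
  lookup-injective = unique-lookup
    (Unique.filter⁺ edge? (Unique.cartesianProduct⁺ (Unique.allFin⁺ order) (Unique.allFin⁺ order)))

  -- With equal orientations the two list entries agree, and the list has no repetitions. Opposite
  -- orientations contradict that the smaller end is listed first.
  joins-unique : ∀ {e e′ u v} → Joins e u v → Joins e′ u v → e ≡ e′
  joins-unique (inj₁ (a , b)) (inj₁ (c , d)) = lookup-injective (cong₂ _,_ (trans (sym a) c) (trans (sym b) d))
  joins-unique (inj₂ (a , b)) (inj₂ (c , d)) = lookup-injective (cong₂ _,_ (trans (sym b) d) (trans (sym a) c))
  joins-unique {e} {e′} (inj₁ (refl , refl)) (inj₂ (c , d)) =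
    ⊥-elim (ℕ.<-asym (proj₁ (ends-edge e′)) (subst₂ _<_ (cong toℕ c) (cong toℕ d) (proj₁ (ends-edge e))))
  joins-unique {e} {e′} (inj₂ (refl , refl)) (inj₁ (c , d)) =
    ⊥-elim (ℕ.<-asym (proj₁ (ends-edge e′)) (subst₂ _<_ (cong toℕ d) (cong toℕ c) (proj₁ (ends-edge e))))

  incident-joins : ∀ {e u v} → Incident G u e → Incident G v e → u ≢ v → Joins e u v
  incident-joins (inj₁ a) (inj₁ b) u≢v = ⊥-elim (u≢v (trans a (sym b)))
  incident-joins (inj₁ a) (inj₂ b) _   = inj₁ (a , b)
  incident-joins (inj₂ a) (inj₁ b) _   = inj₂ (a , b)
  incident-joins (inj₂ a) (inj₂ b) u≢v = ⊥-elim (u≢v (trans a (sym b)))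

  joins-incident : ∀ {e u v} → Joins e u v → Incident G u e × Incident G v e
  joins-incident (inj₁ (a , b)) = inj₁ a , inj₂ b
  joins-incident (inj₂ (a , b)) = inj₂ a , inj₁ b

  other-end : ∀ {e v} → Incident G v e → ∃ λ w → Joins e v w
  other-end (inj₁ a) = _ , inj₁ (a , refl)
  other-end (inj₂ b) = _ , inj₂ (b , refl)

  incident-other : ∀ {e u v w} → Joins e v w → Incident G u e → u ≢ v → u ≡ w
  incident-other (inj₁ (refl , refl)) (inj₁ c) u≢v = ⊥-elim (u≢v c)
  incident-other (inj₁ (refl , refl)) (inj₂ c) u≢v = c
  incident-other (inj₂ (refl , refl)) (inj₁ c) u≢v = c
  incident-other (inj₂ (refl , refl)) (inj₂ c) u≢v = ⊥-elim (u≢v c)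

  Sub : Rel (V ⊎ Edge) 0ℓ
  Sub = SubdivAdj G

  -- Cut the walk at its first arrival at `e`, which must come from `y` because the incidence of `x`
  -- and `e` is removed. Before that, two steps through some `e′` other than `e` either traverse the
  -- edge `e′` of the graph or turn back, and the latter are dropped.
  project : ∀ {e x y a} → Joins e x y → Walk (Sub ∖⟨ inj₁ x , inj₂ e ⟩) ℓ (inj₁ a) (inj₂ e) →
            ∃ λ k → suc (2 * k) ≤ ℓ × Walk (Adj ∖⟨ x , y ⟩) k a y
  project {e = e} {x} {y} {a} j (_∷_ {v = inj₂ e′} (r , ¬s) p) with e′ Fin.≟ e
  ... | yes refl = 0 , s≤s z≤n ,
    subst (λ z → Walk _ 0 z y) (sym (incident-other j r λ a≡x → ¬s (inj₁ (cong inj₁ a≡x , refl)))) []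
  project {e = e} j (_∷_ {v = inj₂ e′} r []) | no e′≢e = ⊥-elim (e′≢e refl)
  project {e = e} {x} {y} {a} j (_∷_ {v = inj₂ e′} (r , _) (_∷_ {v = inj₁ b} (r′ , _) p)) | no e′≢e
    with project j p | a Fin.≟ b
  ... | k , le , q | yes refl = k , ℕ.m≤n⇒m≤1+n (ℕ.m≤n⇒m≤1+n le) , q
  ... | k , le , q | no a≢b   = suc k , s≤s (ℕ.≤-trans (ℕ.≤-reflexive (ℕ.*-suc 2 k)) (s≤s le)) ,
    ((joins-adj j′ , λ { (inj₁ (refl , refl)) → e′≢e (joins-unique j′ j)
                       ; (inj₂ (refl , refl)) → e′≢e (joins-unique (samePair-sym j′) j) }) ∷ q)
    where j′ = incident-joins r r′ a≢b

  incidence-girth : GirthAbove g Adj → ∀ {x e} → Incident G x e → ∀ {ℓ} → ℓ ≤ suc (2 * g) →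
                    ¬ Walk (Sub ∖⟨ inj₁ x , inj₂ e ⟩) ℓ (inj₁ x) (inj₂ e)
  incidence-girth girth r ℓ≤ p with other-end r
  ... | y , j with project j p
  ... | k , le , q = girth (joins-adj j) (ℕ.*-cancelˡ-≤ 2 (s≤s⁻¹ (ℕ.≤-trans le ℓ≤))) q

  -- Cycle lengths double: excluding lengths up to `g + 1` in the graph excludes lengths up to
  -- `2 * g + 2` in its subdivision.
  subdivide-girth : GirthAbove g Adj → GirthAbove (suc (2 * g)) Sub
  subdivide-girth girth {inj₁ _} {inj₂ _} r ℓ≤ p = incidence-girth girth r ℓ≤ p
  subdivide-girth girth {inj₂ _} {inj₁ _} r ℓ≤ p = incidence-girth girth r ℓ≤
    (map id (λ (s , ¬s) → s , ¬s ∘ swap)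
      (reverse (∖-sym {R = Sub} (λ {a} {b} → subdivAdj-sym G {a} {b})) p))

  closed-walk-even : ∀ {ℓ x} → Walk Sub ℓ x x → 2 ∣ ℓ
  closed-walk-even {x = inj₁ _} = from-vertex
    where
    from-vertex : ∀ {ℓ a b} → Walk Sub ℓ (inj₁ a) (inj₁ b) → 2 ∣ ℓ
    from-vertex []                                              = divides 0 refl
    from-vertex (_∷_ {v = inj₂ _} _ (_∷_ {v = inj₁ _} _ p)) = ∣m∣n⇒∣m+n ∣-refl (from-vertex p)
  closed-walk-even {x = inj₂ _} = from-edge
    where
    from-edge : ∀ {ℓ a b} → Walk Sub ℓ (inj₂ a) (inj₂ b) → 2 ∣ ℓ
    from-edge []                                              = divides 0 refl
    from-edge (_∷_ {v = inj₁ _} _ (_∷_ {v = inj₂ _} _ p)) = ∣m∣n⇒∣m+n ∣-refl (from-edge p)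

  split : Graph.V (subdivide G) → V ⊎ Edge
  split = splitAt order

  split-injective : Injective _≡_ _≡_ split
  split-injective {x} {y} eq = trans (sym (Fin.join-splitAt order _ x))
    (trans (cong (join order _) eq) (Fin.join-splitAt order _ y))

  ⟦_⟧ : V ⊎ Edge → Graph.V (subdivide G)
  ⟦_⟧ = join order _

  ⟦⟧-adj : ∀ a b → Sub a b → Graph.Adj (subdivide G) ⟦ a ⟧ ⟦ b ⟧
  ⟦⟧-adj a b = subst₂ Sub (sym (Fin.splitAt-join order _ a)) (sym (Fin.splitAt-join order _ b))

  ⟦⟧-injective : ∀ {a b} → ⟦ a ⟧ ≡ ⟦ b ⟧ → a ≡ b
  ⟦⟧-injective {a} {b} eq = trans (sym (Fin.splitAt-join order _ a))
    (trans (cong split eq) (Fin.splitAt-join order _ b))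

  no-odd-cycle : 2 ≤ n → C n IsSubgraphOf subdivide G → 2 ∣ n
  no-odd-cycle {suc (suc n)} _ (f , _ , hom) = closed-walk-even
    (subst (λ k → Walk Sub (suc k) (split (f zero)) (split (f zero))) (Fin.toℕ-fromℕ (suc n))
    (walk-along {R = Sub} (split ∘ f) (λ i → hom _ _ (cycle-step i)) (fromℕ (suc n)) ∷ʳ
      hom _ _ (Graph.adj-sym (C (2 + n)) (cycle-close n))))
  no-odd-cycle {suc zero} (s≤s ())

  no-triangle : ∀ {x y z} → Sub x y → Sub y z → ¬ Sub x z
  no-triangle {inj₁ _} {inj₂ _} {inj₁ _} _ _ ()
  no-triangle {inj₂ _} {inj₁ _} {inj₂ _} _ _ ()

  subdivide-cliqueNumber : ∀ {u v} → Adj u v → IsCliqueNumber (subdivide G) 2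
  subdivide-cliqueNumber {u} {v} r = (f , f-inj , f-hom) , bound
    where
    e = proj₁ (edge-joining r)
    f : Fin 2 → Graph.V (subdivide G)
    f zero       = ⟦ inj₁ u ⟧
    f (suc zero) = ⟦ inj₂ e ⟧
    f-hom : ∀ i j → i ≢ j → Graph.Adj (subdivide G) (f i) (f j)
    f-hom zero       zero       i≢j = ⊥-elim (i≢j refl)
    f-hom (suc zero) (suc zero) i≢j = ⊥-elim (i≢j refl)
    f-hom zero (suc zero) _ = ⟦⟧-adj (inj₁ u) (inj₂ e) (proj₁ (joins-incident (proj₂ (edge-joining r))))
    f-hom (suc zero) zero _ = ⟦⟧-adj (inj₂ e) (inj₁ u) (proj₁ (joins-incident (proj₂ (edge-joining r))))
    f-inj : Injective _≡_ _≡_ f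
    f-inj {i} {j} eq with i Fin.≟ j
    ... | yes i≡j = i≡j
    ... | no i≢j  = ⊥-elim (Graph.adj-irrefl (subdivide G) eq (f-hom i j i≢j))
    bound : ∀ j → K j IsSubgraphOf subdivide G → j ≤ 2
    bound 0 _ = z≤n
    bound 1 _ = s≤s z≤n
    bound 2 _ = ℕ.≤-refl
    bound (suc (suc (suc _))) (h , _ , hom) = ⊥-elim (no-triangle
      {split (h zero)} {split (h (suc zero))} {split (h (suc (suc zero)))}
      (hom zero (suc zero) λ ()) (hom (suc zero) (suc (suc zero)) λ ())
      (hom zero (suc (suc zero)) λ ()))

-- Star colourings

-- If all `m + 1` colours occurred around the next vertex, choosing one neighbour per colour would
-- give it `m + 1` distinct neighbours.
greedy-coloring : {R : Rel (Fin n) 0ℓ} → Decidable R → Symmetric R → Irreflexive _≡_ R →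
  (∀ w (N : Fin (suc m) → Fin n) → Injective _≡_ _≡_ N → ¬ (∀ a → R w (N a))) →
  ∃ λ (h : Fin n → Fin (suc m)) → Proper R h
greedy-coloring {n} {m} {R} R? R-sym R-irrefl sparse =
  let h , proper = color n ℕ.≤-refl in h , λ u v → proper u v (Fin.toℕ<n u) (Fin.toℕ<n v)
  where
  Colored : ℕ → Set
  Colored i = ∃ λ (h : Fin n → Fin (suc m)) → ∀ u v → toℕ u < i → toℕ v < i → R u v → h u ≢ h v

  color : ∀ i → i ≤ n → Colored i
  color zero    _   = (λ _ → zero) , λ _ _ ()
  color (suc i) i<n with color i (ℕ.<⇒≤ i<n)
  ... | h , proper = extend (Fin.all? used?)
    where
    z = fromℕ< i<n

    -- Neighbours still to be coloured count as well, with their provisional colour; the degree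
    -- bound leaves room for them.
    Used : Fin (suc m) → Set
    Used a = ∃ λ v → R z v × h v ≡ a

    used? : ∀ a → Dec (Used a)
    used? a = Fin.any? λ v → R? z v ×-dec (h v Fin.≟ a)

    extend : Dec (∀ a → Used a) → Colored (suc i)
    extend (yes all-used) = ⊥-elim (sparse z (λ a → proj₁ (all-used a))
      (λ {a} {b} eq → trans (sym (proj₂ (proj₂ (all-used a))))
                        (trans (cong h eq) (proj₂ (proj₂ (all-used b)))))
      (λ a → proj₁ (proj₂ (all-used a))))
    extend (no ¬all) with Fin.¬∀⟶∃¬ (suc m) Used used? ¬all
    ... | a , free = h′ , proper′
      where
      h′ : Fin n → Fin (suc m)
      h′ v with v Fin.≟ z
      ... | yes _ = a
      ... | no _  = h v

      below : ∀ {v} → v ≢ z → toℕ v < suc i → toℕ v < i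
      below v≢z v≤i = ℕ.≤∧≢⇒< (s≤s⁻¹ v≤i) λ eq →
        v≢z (Fin.toℕ-injective (trans eq (sym (Fin.toℕ-fromℕ< i<n))))

      proper′ : ∀ u v → toℕ u < suc i → toℕ v < suc i → R u v → h′ u ≢ h′ v
      proper′ u v u≤i v≤i r eq with u Fin.≟ z | v Fin.≟ z
      ... | yes refl | yes refl = R-irrefl refl r
      ... | yes refl | no _     = free (v , r , sym eq)
      ... | no _     | yes refl = free (u , R-sym r , eq)
      ... | no u≢z   | no v≢z   = proper u v (below u≢z u≤i) (below v≢z v≤i) r eq

module StarColoring (H : Graph) {m} (col : Graph.V (subdivide H) → Fin m)
                    (star : IsStarColoring (subdivide H) col) where
  open Subdivision H
  private module S = Graph (subdivide H)

  c : V ⊎ Edge → Fin m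
  c = col ∘ ⟦_⟧

  -- Otherwise the path u, e, v, f would be bicoloured.
  edges-differ : ∀ {u v w e f} → Joins e v u → Joins f v w → u ≢ w →
                 c (inj₁ u) ≡ c (inj₁ v) → c (inj₂ e) ≢ c (inj₂ f)
  edges-differ {u} {v} {w} {e} {f} je jf u≢w cu≡cv ce≡cf = no-centre
    (proj₂ star (c (inj₁ v)) (c (inj₂ e)) (proj₁ star _ _ ve) ⟦ inj₁ v ⟧ (inj₁ refl))
    where
    Two : S.V → Set
    Two x = col x ≡ c (inj₁ v) ⊎ col x ≡ c (inj₂ e)

    ve : S.Adj ⟦ inj₁ v ⟧ ⟦ inj₂ e ⟧
    ve = ⟦⟧-adj (inj₁ v) (inj₂ e) (proj₁ (joins-incident je))
    v→e : (subdivide H [ Two ]) ⟦ inj₁ v ⟧ ⟦ inj₂ e ⟧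
    v→e = inj₁ refl , inj₂ refl , ve
    v→f : (subdivide H [ Two ]) ⟦ inj₁ v ⟧ ⟦ inj₂ f ⟧
    v→f = inj₁ refl , inj₂ (sym ce≡cf) , ⟦⟧-adj (inj₁ v) (inj₂ f) (proj₁ (joins-incident jf))
    e→u : (subdivide H [ Two ]) ⟦ inj₂ e ⟧ ⟦ inj₁ u ⟧
    e→u = inj₂ refl , inj₁ cu≡cv , ⟦⟧-adj (inj₂ e) (inj₁ u) (proj₂ (joins-incident je))

    e≢f : e ≢ f
    e≢f refl = u≢w (incident-other jf (proj₂ (joins-incident je))
      λ { refl → adj-irrefl refl (joins-adj je) })

    -- The centre `z` lies on each of the edges `v e`, `v f` and `e u`. The first leaves `z = v`,
    -- which is not on `e u`, or `z = e`, which is not on `v f`.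
    no-centre : ¬ _
    no-centre (z , _ , char)
      with proj₂ (Equivalence.to (char _ _ ε (v→e ◅ ε)) v→e)
         | proj₂ (Equivalence.to (char _ _ ε (v→f ◅ ε)) v→f)
         | proj₂ (Equivalence.to (char _ _ (v→e ◅ ε) (v→e ◅ e→u ◅ ε)) e→u)
    ... | inj₁ v≡z | _        | inj₁ e≡z
      with () ← ⟦⟧-injective {inj₁ v} {inj₂ e} (trans v≡z (sym e≡z))
    ... | inj₁ v≡z | _        | inj₂ u≡z
      with refl ← ⟦⟧-injective {inj₁ v} {inj₁ u} (trans v≡z (sym u≡z)) =
      adj-irrefl refl (joins-adj je)
    ... | inj₂ e≡z | inj₁ v≡z | _
      with () ← ⟦⟧-injective {inj₁ v} {inj₂ e} (trans v≡z (sym e≡z))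
    ... | inj₂ e≡z | inj₂ f≡z | _
      with refl ← ⟦⟧-injective {inj₂ e} {inj₂ f} (trans e≡z (sym f≡z)) = e≢f refl

  Mono : Rel V 0ℓ
  Mono u v = Adj u v × c (inj₁ u) ≡ c (inj₁ v)

  -- By `edges-differ`, the monochromatic edges at a vertex have subdivision vertices of distinct
  -- colours, so by the pigeonhole principle there are at most `m` of them.
  mono-coloring : ∃ λ (h : V → Fin (suc m)) → Proper Mono h
  mono-coloring = greedy-coloring
    (λ u v → adj? u v ×-dec (c (inj₁ u) Fin.≟ c (inj₁ v)))
    (λ (r , eq) → adj-sym r , sym eq)
    (λ u≡v (r , _) → adj-irrefl u≡v r)
    λ w N N-inj nbr →
      let e = λ a → edge-joining (proj₁ (nbr a))
          a , b , a<b , eq = Fin.pigeonhole ℕ.≤-refl (c ∘ inj₂ ∘ proj₁ ∘ e)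
      in edges-differ (proj₂ (e a)) (proj₂ (e b)) (λ Na≡Nb → Fin.<⇒≢ a<b (N-inj Na≡Nb))
           (sym (proj₂ (nbr a))) eq

  proper-coloring : ∃ λ (h : V → Fin (m * suc m)) → Proper Adj h
  proper-coloring = let h , proper = mono-coloring in
    (λ v → combine (c (inj₁ v)) (h v)) ,
    λ u v r eq → let c≡ , h≡ = Fin.combine-injective (c (inj₁ u)) (h u) (c (inj₁ v)) (h v) eq
                 in proper u v (r , c≡) h≡

-- Two classes contain only `a` and `b`, which form either one edge, with centre `a`, or two
-- isolated vertices. This bounds the search for the star chromatic number.
identity-starColorable : ∀ G → StarColorable G (Graph.order G)
identity-starColorable G = id , (λ u v r u≡v → adj-irrefl u≡v r) , star
  where
  open Graph G
  star : ∀ a b → a ≢ b → InducesStarForest G (λ v → v ≡ a ⊎ v ≡ b)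
  star a b a≢b v pv with adj? a b
  ... | yes r = a , reach pv , λ u w v→u v→w → mk⇔
          (λ (pu , pw , s) → (λ u≡w → adj-irrefl u≡w s) , centre pu pw s)
          (λ (u≢w , c) → let pu = inside pv v→u ; pw = inside pv v→w in pu , pw , joined pu pw u≢w c)
    where
    Two : V → Set
    Two v = v ≡ a ⊎ v ≡ b
    inside : ∀ {v u} → Two v → Star (G [ Two ]) v u → Two u
    inside pv ε                  = pv
    inside _  ((_ , pw , _) ◅ s) = inside pw s
    reach : ∀ {v} → Two v → Star (G [ Two ]) v a
    reach (inj₁ refl) = ε
    reach (inj₂ refl) = (inj₂ refl , inj₁ refl , adj-sym r) ◅ ε
    centre : ∀ {u w} → Two u → Two w → Adj u w → u ≡ a ⊎ w ≡ a
    centre (inj₁ u≡a)  _           _ = inj₁ u≡a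
    centre (inj₂ _)    (inj₁ w≡a)  _ = inj₂ w≡a
    centre (inj₂ refl) (inj₂ refl) s = ⊥-elim (adj-irrefl refl s)
    joined : ∀ {u w} → Two u → Two w → u ≢ w → u ≡ a ⊎ w ≡ a → Adj u w
    joined (inj₁ refl) (inj₁ refl) u≢w _ = ⊥-elim (u≢w refl)
    joined (inj₁ refl) (inj₂ refl) _   _ = r
    joined (inj₂ refl) (inj₁ refl) _   _ = adj-sym r
    joined (inj₂ refl) (inj₂ refl) u≢w _ = ⊥-elim (u≢w refl)
  ... | no ¬r = v , ε , λ u w v→u v→w → mk⇔
          (λ p → ⊥-elim (isolated p))
          (λ (u≢w , _) → ⊥-elim (u≢w (trans (sym (stuck v→u)) (stuck v→w))))
    where
    Two : V → Set
    Two v = v ≡ a ⊎ v ≡ b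
    isolated : ∀ {u w} → ¬ (G [ Two ]) u w
    isolated (inj₁ refl , inj₁ refl , s) = adj-irrefl refl s
    isolated (inj₁ refl , inj₂ refl , s) = ¬r s
    isolated (inj₂ refl , inj₁ refl , s) = ¬r (adj-sym s)
    isolated (inj₂ refl , inj₂ refl , s) = adj-irrefl refl s
    stuck : ∀ {u w} → Star (G [ Two ]) u w → u ≡ w
    stuck ε       = refl
    stuck (s ◅ _) = ⊥-elim (isolated s)

-- Star colourability is not decided here, so the least number of colours is obtained only up to
-- double negation. This suffices for refuting boundedness.
¬¬-starChromaticNumber : ∀ G → ¬ ¬ ∃ (IsStarChromaticNumber G)
¬¬-starChromaticNumber G none = <-rec (λ m → ¬ StarColorable G m)
  (λ m smaller s → none (m , s , λ j t → ℕ.≮⇒≥ λ j<m → smaller j<m t)) _ (identity-starColorable G)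

-- Forests in subdivisions

walk-star : Walk R ℓ u v → Star R u v
walk-star []      = ε
walk-star (r ∷ p) = r ◅ walk-star p

acyclic-forest : (G : Graph) → Acyclic (Graph.Adj G) → IsForest G
acyclic-forest G acyclic n 3≤n (f , inj , hom) =
  girth-noCycle (acyclic n) 3≤n (ℕ.n≤1+n n) f inj hom

-- The vertices are treated in turn: one that cannot be reached from `zero` is joined to it, which
-- creates no cycle. Reachability is not decided, hence the double negation.
spanning-tree : (F : GraphOn n) → 0 < n → Acyclic (GraphOn.Adj F) →
  ¬ ¬ ∃ λ (R : GraphOn n) → IsTree (graph R) × (∀ {u v} → GraphOn.Adj F u v → GraphOn.Adj R u v)
spanning-tree {suc n} F 0<n acyclic none = attach (suc n) ℕ.≤-refl λ
  (R , acyclicR , F⊆R , connected) → none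
    (R , (0<n , (λ u v → Star.reverse (GraphOn.adj-sym R) (connected u (Fin.toℕ<n u)) ◅◅
                         connected v (Fin.toℕ<n v))
             , acyclic-forest (graph R) acyclicR) , F⊆R)
  where
  Stage : ℕ → Set₁
  Stage i = ∃ λ (R : GraphOn (suc n)) → Acyclic (GraphOn.Adj R) ×
    (∀ {u v} → GraphOn.Adj F u v → GraphOn.Adj R u v) ×
    (∀ v → toℕ v < i → Star (GraphOn.Adj R) zero v)

  attach : ∀ i → i ≤ suc n → ¬ ¬ Stage i
  attach zero    _   k = k (F , acyclic , id , λ _ ())
  attach (suc i) i<n k = attach i (ℕ.<⇒≤ i<n) λ (R , acyclicR , F⊆R , connected) →
    let open GraphOn R
        z = fromℕ< i<n
        split : ∀ {P : Fin (suc n) → Set} → (∀ v → toℕ v < i → P v) → P z →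
                ∀ v → toℕ v < suc i → P v
        split {P} below at-z v v≤i = case ℕ.m≤n⇒m<n∨m≡n (s≤s⁻¹ v≤i) of λ
          { (inj₁ v<i) → below v v<i
          ; (inj₂ v≡i) → subst P (Fin.toℕ-injective (trans (Fin.toℕ-fromℕ< i<n) (sym v≡i))) at-z }
    in ¬¬-excluded-middle {A = ∃ λ ℓ → Walk Adj ℓ zero z} λ
    { (yes (_ , p)) → k (R , acyclicR , F⊆R , split connected (walk-star p))
    ; (no apart)    →
        let 0≢z : zero ≢ z
            0≢z 0≡z = apart (0 , subst (Walk Adj 0 zero) 0≡z [])
        in k (addEdge R 0≢z
             , (λ g → ∪-girth adj-sym (acyclicR g) λ _ p → apart (_ , p))
             , (λ r → inj₁ (F⊆R r))
             , split (λ v v<i → Star.map inj₁ (connected v v<i)) (inj₂ (inj₁ (refl , refl)) ◅ ε)) }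

-- `B` stands for the non-isolated vertices of `T` placed on subdivision vertices. Every edge of `T`
-- then has exactly one end in `B`, and the vertices of `B` have degree 1 or 2.
module Contraction (T : Graph) (acyclic : Acyclic (Graph.Adj T))
  {B : Pred (Graph.V T) 0ℓ} (B? : U.Decidable B)
  (B-independent : ∀ {t u} → Graph.Adj T t u → B t → ¬ B u)
  (B-covers : ∀ {t u} → Graph.Adj T t u → ¬ B t → B u)
  (B-neighbour : ∀ {t} → B t → ∃ (Graph.Adj T t))
  (B-degree≤2 : ∀ {t a b z} → B t → Graph.Adj T t a → Graph.Adj T t b → a ≢ b →
                Graph.Adj T t z → z ≡ a ⊎ z ≡ b)
  where
  open Graph T

  -- Contracting t creates the edge between p t and r t. A vertex t ∈ B with the single
  -- neighbour p t has r t = t and thus turns into a leaf, to leave an edge for t to subdivide.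
  p r : V → V
  p t with Fin.any? (adj? t)
  ... | yes (a , _) = a
  ... | no _        = t
  r t with Fin.any? (λ z → adj? t z ×-dec ¬? (z Fin.≟ p t))
  ... | yes (z , _) = z
  ... | no _        = t

  p-adj : ∀ {t} → B t → Adj t (p t)
  p-adj {t} b with Fin.any? (adj? t)
  ... | yes (_ , s) = s
  ... | no isolated = ⊥-elim (isolated (B-neighbour b))

  r-spec : ∀ t → (Adj t (r t) × r t ≢ p t) ⊎ (r t ≡ t × (∀ z → Adj t z → z ≡ p t))
  r-spec t with Fin.any? (λ z → adj? t z ×-dec ¬? (z Fin.≟ p t))
  ... | yes (_ , s , z≢p) = inj₁ (s , z≢p)
  ... | no only           = inj₂ (refl , λ z s → decidable-stable (z Fin.≟ p t) λ z≢p → only (z , s , z≢p))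

  p≢r : ∀ {t} → B t → p t ≢ r t
  p≢r {t} b p≡r with r-spec t
  ... | inj₁ (_ , r≢p) = r≢p (sym p≡r)
  ... | inj₂ (r≡t , _) = adj-irrefl (sym (trans p≡r r≡t)) (p-adj b)

  neighbours : ∀ {t z} → B t → Adj t z → z ≡ p t ⊎ z ≡ r t
  neighbours {t} b s with r-spec t
  ... | inj₁ (s′ , _)  = B-degree≤2 b (p-adj b) s′ (p≢r b) s
  ... | inj₂ (_ , only) = inj₁ (only _ s)

  Via : V → V → V → Set
  Via t u v = B t × SamePair (p t) (r t) u v

  via-near : ∀ {t u v} → Via t u v → (Adj t u ⊎ u ≡ t) × (Adj t v ⊎ v ≡ t)
  via-near {t} (b , s) = ends s
    where
    at-r : Adj t (r t) ⊎ r t ≡ t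
    at-r with r-spec t
    ... | inj₁ (s , _)   = inj₁ s
    ... | inj₂ (r≡t , _) = inj₂ r≡t
    ends : ∀ {u v} → SamePair (p t) (r t) u v → (Adj t u ⊎ u ≡ t) × (Adj t v ⊎ v ≡ t)
    ends (inj₁ (refl , refl)) = inj₁ (p-adj b) , at-r
    ends (inj₂ (refl , refl)) = at-r , inj₁ (p-adj b)

  no-square : ∀ {t t′ u v} → t ≢ t′ → u ≢ v → Adj t u → Adj t v → Adj t′ u → Adj t′ v → ⊥
  no-square t≢t′ u≢v tu tv t′u t′v = acyclic 3 tu ℕ.≤-refl
    ( (tv , λ { (inj₁ (_ , v≡u)) → u≢v (sym v≡u) ; (inj₂ (_ , v≡t)) → adj-irrefl (sym v≡t) tv })
    ∷ (adj-sym t′v , λ { (inj₁ (v≡t , _)) → adj-irrefl (sym v≡t) tv ; (inj₂ (v≡u , _)) → u≢v (sym v≡u) })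
    ∷ (t′u , λ { (inj₁ (t′≡t , _)) → t≢t′ (sym t′≡t) ; (inj₂ (t′≡u , _)) → adj-irrefl t′≡u t′u })
    ∷ [])

  -- Distinct `t` and `t′` with two common neighbours would close a 4-cycle in `T`. If an end is `t`
  -- or `t′` itself, the two coincide or are adjacent, and the latter contradicts the independence
  -- of `B`.
  via-unique : ∀ {t t′ u v} → Via t u v → Via t′ u v → t ≡ t′
  via-unique {t} {t′} x@(b , s) x′@(b′ , _) with t Fin.≟ t′
  ... | yes t≡t′ = t≡t′
  ... | no t≢t′ with via-near x | via-near x′
  ... | inj₁ tu   , inj₁ tv   | inj₁ t′u  , inj₁ t′v  = ⊥-elim (no-square t≢t′ (distinct s) tu tv t′u t′v)
    where
    distinct : ∀ {u v} → SamePair (p t) (r t) u v → u ≢ v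
    distinct (inj₁ (refl , refl)) = p≢r b
    distinct (inj₂ (refl , refl)) = p≢r b ∘ sym
  ... | inj₂ refl , _         | inj₁ t′u  , _         = ⊥-elim (B-independent t′u b′ b)
  ... | inj₂ refl , _         | inj₂ refl , _         = refl
  ... | _         , inj₂ refl | _         , inj₁ t′v  = ⊥-elim (B-independent t′v b′ b)
  ... | _         , inj₂ refl | _         , inj₂ refl = refl
  ... | inj₁ tu   , _         | inj₂ refl , _         = ⊥-elim (B-independent tu b b′)
  ... | _         , inj₁ tv   | _         , inj₂ refl = ⊥-elim (B-independent tv b b′)

  -- The vertex set of `T` is kept: vertices of `B` with two neighbours remain as isolated vertices,
  -- those with one as leaves.
  F : GraphOn order
  F = record
    { Adj        = λ u v → ∃ λ t → Via t u v
    ; adj?       = λ u v → Fin.any? λ t → B? t ×-dec samePair? (p t) (r t) u v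
    ; adj-sym    = λ (t , b , s) → t , b , samePair-sym s
    ; adj-irrefl = λ { refl (t , b , inj₁ (a , c)) → p≢r b (trans (sym a) c)
                     ; refl (t , b , inj₂ (a , c)) → p≢r b (trans (sym c) a) }
    }

  open GraphOn F using () renaming (Adj to AdjF; adj-sym to F-sym)

  -- An edge of `F` via `t′` becomes at most two steps through `t′`. They avoid the edge between `t`
  -- and `p t`, because `t′` differs from `t` by the removal and `p t` is not in `B`.
  lift : ∀ {t} → B t → Walk (AdjF ∖⟨ p t , r t ⟩) ℓ u v → ∃ λ k → Walk (Adj ∖⟨ t , p t ⟩) k u v
  lift b [] = 0 , []
  lift {t = t} b (((t′ , b′ , s) , ¬s) ∷ w) =
    let near-u , near-v = via-near (b′ , s)
        _ , w₁ = hop near-u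
        _ , w₂ = hop near-v
        _ , w₃ = lift b w
    in _ , (w₁ ++ reverse (∖-sym adj-sym) w₂ ++ w₃)
    where
    t′≢t : t′ ≢ t
    t′≢t refl = ¬s s
    hop : ∀ {x} → Adj t′ x ⊎ x ≡ t′ → ∃ λ k → Walk (Adj ∖⟨ t , p t ⟩) k x t′
    hop (inj₂ refl) = 0 , []
    hop (inj₁ t′x)  = 1 , (adj-sym t′x , λ
      { (inj₁ (_ , refl)) → B-independent (p-adj b) b b′
      ; (inj₂ (_ , t′≡t)) → t′≢t t′≡t }) ∷ []

  -- If `t` has two neighbours, the lifted walk, continued from `r t` to `t`, bypasses the edge
  -- between `t` and `p t` in `T`. If it has one, `r t = t` is a leaf of `F` whose only edge is
  -- removed.
  ends-disconnected : ∀ {t} → B t → ¬ Walk (AdjF ∖⟨ p t , r t ⟩) ℓ (p t) (r t)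
  ends-disconnected {t = t} b w with r-spec t
  ... | inj₁ (tr , r≢p) =
    let k , w′ = lift b w in acyclic (suc k) (p-adj b) ℕ.≤-refl
      (reverse (∖-sym adj-sym) (w′ ∷ʳ (adj-sym tr , λ
        { (inj₁ (_ , t≡p)) → adj-irrefl t≡p (p-adj b) ; (inj₂ (r≡p , _)) → r≢p r≡p })))
  ... | inj₂ (r≡t , _) = first-step (reverse (∖-sym F-sym) w) refl refl
    where
    first-step : ∀ {x y} → Walk (AdjF ∖⟨ p t , r t ⟩) ℓ x y → x ≡ r t → y ≡ p t → ⊥
    first-step [] x≡r x≡p = p≢r b (trans (sym x≡p) x≡r)
    first-step (((t′ , via@(b′ , s)) , ¬s) ∷ _) refl _ with proj₁ (via-near via)
    ... | inj₁ t′r  = B-independent t′r b′ (subst B (sym r≡t) b)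
    ... | inj₂ r≡t′ with refl ← trans (sym r≡t) r≡t′ = ¬s s

  F-acyclic : Acyclic AdjF
  F-acyclic _ (t , b , inj₁ (refl , refl)) _ w = ends-disconnected b w
  F-acyclic _ (t , b , inj₂ (refl , refl)) _ w = ends-disconnected b
    (map id (λ (s , ¬s) → s , ¬s ∘ swap) (reverse (∖-sym F-sym) w))

  module _ (R : GraphOn order) (F⊆R : ∀ {u v} → AdjF u v → GraphOn.Adj R u v) where
    open Subdivision (graph R)
      using (Edge; ⟦_⟧; ⟦⟧-adj; ⟦⟧-injective; Joins; Sub; edge-joining; joins-incident)

    edge : ∀ {t} → B t → ∃ λ e → Joins e (p t) (r t)
    edge b = edge-joining (F⊆R (_ , b , inj₁ (refl , refl)))

    image : ∀ {t} → Dec (B t) → V ⊎ Edge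
    image     (yes b) = inj₂ (proj₁ (edge b))
    image {t} (no _)  = inj₁ t

    same-ends : ∀ {a b c d u v : V} → SamePair a b u v → SamePair a b c d → SamePair u v c d
    same-ends (inj₁ (refl , refl)) s = s
    same-ends (inj₂ (refl , refl)) s = swap s

    image-injective : ∀ {t t′} (b? : Dec (B t)) (b′? : Dec (B t′)) → image b? ≡ image b′? → t ≡ t′
    image-injective (no _)  (no _)   refl = refl
    image-injective (yes b) (yes b′) eq with edge b | edge b′
    image-injective (yes b) (yes b′) refl | e , j | _ , j′ =
      via-unique (b , same-ends j j′) (b′ , inj₁ (refl , refl))
    image-injective (yes _) (no _) ()
    image-injective (no _) (yes _) ()

    incident : ∀ {t u} (b : B t) → Adj t u → Incident (graph R) u (proj₁ (edge b))
    incident b s with neighbours b s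
    ... | inj₁ refl = proj₁ (joins-incident (proj₂ (edge b)))
    ... | inj₂ refl = proj₂ (joins-incident (proj₂ (edge b)))

    image-adj : ∀ {t t′} (b? : Dec (B t)) (b′? : Dec (B t′)) → Adj t t′ → Sub (image b?) (image b′?)
    image-adj (yes b) (yes b′) s = B-independent s b b′
    image-adj (yes b) (no _)   s = incident b s
    image-adj (no _)  (yes b′) s = incident b′ (adj-sym s)
    image-adj (no ¬b) (no ¬b′) s = ¬b′ (B-covers s ¬b)

    embeds : T IsSubgraphOf subdivide (graph R)
    embeds = (λ t → ⟦ image (B? t) ⟧)
           , (λ {t} {t′} eq → image-injective (B? t) (B? t′) (⟦⟧-injective eq))
           , λ t t′ s → ⟦⟧-adj _ _ (image-adj (B? t) (B? t′) s)

module _ (T H : Graph) (forest : IsForest T) (emb : T IsSubgraphOf subdivide H) where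
  open Graph T
  private
    module H = Subdivision H
    f = proj₁ emb

    σ : V → H.V ⊎ H.Edge
    σ = H.split ∘ f

    σ-injective : ∀ {u v} → σ u ≡ σ v → u ≡ v
    σ-injective = proj₁ (proj₂ emb) ∘ H.split-injective

    σ-adj : ∀ {u v} → Adj u v → H.Sub (σ u) (σ v)
    σ-adj {u} {v} = proj₂ (proj₂ emb) u v

    -- Isolated vertices of T are left out even when they lie on subdivision vertices:
    -- the contracted forest has no edge for them.
    B : Pred V 0ℓ
    B t = (∃ λ e → σ t ≡ inj₂ e) × ∃ (Adj t)

    B? : U.Decidable B
    B? t = edge? (σ t) ×-dec Fin.any? (adj? t)
      where
      edge? : ∀ x → Dec (∃ λ e → x ≡ inj₂ e)
      edge? (inj₁ _) = no λ ()
      edge? (inj₂ e) = yes (e , refl)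

    B-independent : ∀ {t u} → Adj t u → B t → ¬ B u
    B-independent s ((_ , eq) , _) ((_ , eq′) , _) with () ← subst₂ H.Sub eq eq′ (σ-adj s)

    B-covers : ∀ {t u} → Adj t u → ¬ B t → B u
    B-covers {t} {u} s ¬b with σ t in eq | σ u in eq′ | σ-adj s
    ... | inj₂ _ | _      | _ = ⊥-elim (¬b ((_ , refl) , u , s))
    ... | inj₁ _ | inj₂ _ | _ = (_ , refl) , t , adj-sym s

    incident : ∀ {t e z} → σ t ≡ inj₂ e → Adj t z → ∃ λ x → σ z ≡ inj₁ x × Incident H x e
    incident {z = z} eq s with σ z | subst (λ x → H.Sub x (σ z)) eq (σ-adj s)
    ... | inj₁ x | i = x , refl , i

    B-degree≤2 : ∀ {t a b z} → B t → Adj t a → Adj t b → a ≢ b → Adj t z → z ≡ a ⊎ z ≡ b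
    B-degree≤2 ((_ , eq) , _) ta tb a≢b tz with incident eq ta | incident eq tb | incident eq tz
    ... | x , σa , ix | y , σb , iy | w , σz , iw with w Fin.≟ x
    ... | yes refl = inj₁ (σ-injective (trans σz (sym σa)))
    ... | no w≢x   = inj₂ (σ-injective (trans σz (trans (cong inj₁ w≡y) (sym σb))))
      where
      w≡y : w ≡ y
      w≡y = H.incident-other
        (H.incident-joins ix iy λ { refl → a≢b (σ-injective (trans σa (sym σb))) }) iw w≢x

  private
    open module Contracted =
      Contraction T (forest-acyclic T forest) B? B-independent B-covers proj₂ B-degree≤2
      using (F; F-acyclic; embeds)

  embeds-in-subdivided-tree : ¬ ¬ ∃ λ R → IsTree R × T IsSubgraphOf subdivide R
  embeds-in-subdivided-tree none with order ℕ.≟ 0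
  ... | no ≢0 = spanning-tree F (ℕ.n≢0⇒n>0 ≢0) F-acyclic
    λ (R , tree , F⊆R) → none (graph R , tree , embeds R F⊆R)
  -- A tree has at least one vertex, so for an empty `T` the host is built on a single vertex.
  ... | yes ≡0 = spanning-tree (empty 1) (s≤s z≤n) (λ _ ())
    λ (R , tree , _) → none (graph R , tree , (λ t → absurd t) , (λ {t} → absurd t) , λ t → absurd t)
    where
    absurd : {X : Set} → V → X
    absurd t with () ← subst Fin ≡0 t

-- Refuting boundedness

lemma4 : (T : Graph) → IsForest T →
    ¬ (∃ λ R → IsTree R × T IsSubgraphOf (subdivide R)) →
    (k : ℕ) → 1 ≤ k →
    ¬ χₛ-Bounded (Free T k)
lemma4 T forest T⊈ k 1≤k (f , bound) = counterexample
  -- A star colouring with `m ≤ f 2` colours yields a proper colouring of `H` with `m * (m + 1)`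
  -- colours; the extra colour keeps the number positive when `f 2` is 0.
  (large-girth-and-chromatic (suc (f 2 * suc (f 2))) k)
  where
  counterexample : ¬ (∃₂ λ n (G : GraphOn n) → GirthAbove k (GraphOn.Adj G) ×
    (∀ (h : Fin n → Fin (suc (f 2 * suc (f 2)))) → ¬ Proper (GraphOn.Adj G) h))
  counterexample (n , G , girth , uncolorable) =
    ¬¬-starChromaticNumber (subdivide H) λ (m , χ@((col , star) , _)) →
      let m≤f2 = bound (subdivide H) free m 2 χ clique
          h , proper = StarColoring.proper-coloring H col star
      in uncolorable (λ v → inject≤ (h v) (ℕ.m≤n⇒m≤1+n (ℕ.*-mono-≤ m≤f2 (s≤s m≤f2))))
           (λ u v r eq → proper u v r (Fin.inject≤-injective _ _ _ _ eq))
    where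
    H = graph G
    open Subdivision H

    clique : IsCliqueNumber (subdivide H) 2
    clique with Fin.any? (λ u → Fin.any? (adj? u))
    ... | yes (_ , _ , r) = subdivide-cliqueNumber r
    -- Without edges, a constant colouring would be proper.
    ... | no edgeless     = ⊥-elim (uncolorable (λ _ → zero) λ u v r _ → edgeless (u , v , r))

    induced⇒subgraph : ∀ {K L} → K IsInducedSubgraphOf L → K IsSubgraphOf L
    induced⇒subgraph (g , inj , iff) = g , inj , λ u v → Equivalence.to (iff u v)

    free : Free T k (subdivide H)
    free = (λ ind → embeds-in-subdivided-tree T H forest (induced⇒subgraph {T} {subdivide H} ind) T⊈)
         , (λ n 4≤n n≤2k (g , inj , iff) → girth-noCycle (subdivide-girth girth)
              (ℕ.≤-trans (s≤s (s≤s (s≤s z≤n))) 4≤n)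
              (ℕ.≤-trans n≤2k (ℕ.≤-trans (ℕ.n≤1+n _) (ℕ.n≤1+n _)))
              (split ∘ g) (inj ∘ split-injective) (λ i j → Equivalence.to (iff i j)))
         , λ (n , 5≤n , odd , ind) → odd (no-odd-cycle (ℕ.≤-trans (s≤s (s≤s z≤n)) 5≤n)
              (induced⇒subgraph {C n} {subdivide H} ind))
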